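{- Let $E=\{x_1,\dots,x_n\}\subset\mathbb{R}^2$ with $x_i\,\mathcal{I}\,x_j$ for all $i\neq j$. The Max-Sum-Neighbor $p$-dispersion problem in $E$ is solvable in polynomial time. For $p=2$ and $p=3$ it is solvable in $O(n)$ time using $O(1)$ additional memory space. For $p>3$ there is an algorithm (a dynamic programming algorithm) that solves it to optimality, returning both the optimal value and an optimal selection of $p$ points, in $O(pn^2)$ time and $O(pn)$ memory space.
   Context: For $y=(y^1,y^2),z=(z^1,z^2)\in\mathbb{R}^2$ write $y\prec z$ iff $y^1<z^1$ and $y^2>z^2$, and $y\,\mathcal{I}\,z$ iff $y\prec z$ or $z\prec y$ (so $E$ is a two-dimensional Pareto front). Fix $\alpha>0$, let $d$ be the Euclidean distance on $\mathbb{R}^2$. Since the first coordinates of points of $E$ are pairwise distinct, index $E$ so that $x_1^1<x_2^1<\dots<x_n^1$ (then $x_1\prec x_2\prec\dots\prec x_n$), and set $d_{ij}=d(x_i,x_j)^\alpha$. For an integer $2\le p\le n$, the Max-Sum-Neighbor $p$-dispersion problem is $\max_{1\le i_1<i_2<\dots<i_p\le n}\sum_{j=1}^{p-1}d_{i_j,i_{j+1}}$, i.e. select $p$ points of $E$ maximizing the sum of the dissimilarities between consecutive selected points. Complexities are in a model where arithmetic operations, comparisons and evaluation of $d(\cdot,\cdot)^\alpha$ take $O(1)$ time; "additional memory space" excludes the storage of the input. -}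

module Defs where

open import Algebra.Bundles using (CommutativeRing)
open import Algebra.Structures using (IsCommutativeRing)
import Algebra.Definitions.RawMonoid as RawMonoidDefs
open import Data.Bool using (Bool; true; false; if_then_else_)
open import Data.Fin as Fin using (Fin; toℕ; fromℕ<; inject₁)
open import Data.Fin.Permutation using (Permutation′; _⟨$⟩ʳ_; _⟨$⟩ˡ_)
open import Data.Nat as ℕ using (ℕ; zero; suc; _≡ᵇ_)
open import Data.Product using (_×_; _,_; proj₁; proj₂; ∃; ∃-syntax)
open import Data.Sum using (_⊎_)
open import Relation.Binary.PropositionalEquality using (_≡_; _≢_)
open import Relation.Binary.Structures using (IsStrictTotalOrder)
import Relation.Binary.Construct.StrictToNonStrict as NonStrict
open import Relation.Nullary using (yes; no)
open import Relation.Nullary.Decidable using (⌊_⌋)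

------------------------------------------------------------------------
-- Real numbers

-- The classical reals, given axiomatically as a Dedekind-complete ordered
-- field (hence unique up to isomorphism).  Trichotomy, part of
-- IsStrictTotalOrder, makes comparisons decidable, as a real RAM requires.

record RealNumbers : Set₁ where
  infix  4 _<_ _≤_
  infixl 6 _+_
  infixl 7 _*_
  infix  8 -_ _⁻¹
  infixr 9 _^ʳ_
  field
    ℝ       : Set
    _+_ _*_ : ℝ → ℝ → ℝ
    -_ _⁻¹  : ℝ → ℝ
    0# 1#   : ℝ
    _<_     : ℝ → ℝ → Set

  -- ≤ is "< or ≡".
  _≤_ : ℝ → ℝ → Set
  _≤_ = NonStrict._≤_ _≡_ _<_

  field
    isCommutativeRing  : IsCommutativeRing _≡_ _+_ _*_ -_ 0# 1#
    isStrictTotalOrder : IsStrictTotalOrder _≡_ _<_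
    -- The value of 0# ⁻¹ is unspecified.
    *-inverseʳ         : ∀ {x} → x ≢ 0# → x * x ⁻¹ ≡ 1#
    0<1                : 0# < 1#
    +-monoˡ-<          : ∀ z {x y} → x < y → x + z < y + z
    *-pos              : ∀ {x y} → 0# < x → 0# < y → 0# < x * y
    supremum           : (P : ℝ → Set) → ∃ P →
                         (∃[ b ] ∀ x → P x → x ≤ b) →
                         ∃[ s ] (∀ x → P x → x ≤ s) ×
                                (∀ b → (∀ x → P x → x ≤ b) → s ≤ b)

    sqrt   : ℝ → ℝ
    sqrt-≥ : ∀ {x} → 0# ≤ x → 0# ≤ sqrt x
    sqrt-* : ∀ {x} → 0# ≤ x → sqrt x * sqrt x ≡ x

    -- x ^ʳ a is the real power, for x positive, or x zero and a positive;
    -- elsewhere it is unspecified.  For fixed x > 1 the laws make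
    -- a ↦ x ^ʳ a an increasing homomorphism from (ℝ,+) to (ℝ>0,*) taking
    -- 1 to x, which determines it; ^ʳ-distrib-* then fixes the case
    -- 0 < x ≤ 1.
    _^ʳ_        : ℝ → ℝ → ℝ
    ^ʳ-pos      : ∀ {x} a → 0# < x → 0# < x ^ʳ a
    ^ʳ-1        : ∀ {x} → 0# < x → x ^ʳ 1# ≡ x
    ^ʳ-+        : ∀ {x} a b → 0# < x → x ^ʳ (a + b) ≡ x ^ʳ a * x ^ʳ b
    ^ʳ-distrib-* : ∀ {x y} a → 0# < x → 0# < y →
                  (x * y) ^ʳ a ≡ x ^ʳ a * y ^ʳ a
    ^ʳ-mono-<   : ∀ {x a b} → 1# < x → a < b → x ^ʳ a < x ^ʳ b
    0^ʳ         : ∀ {a} → 0# < a → 0# ^ʳ a ≡ 0#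

  commutativeRing : CommutativeRing _ _
  commutativeRing = record { isCommutativeRing = isCommutativeRing }

  open CommutativeRing commutativeRing public
    using (_-_; +-rawMonoid)
  open IsStrictTotalOrder isStrictTotalOrder public
    using (compare; _<?_)
  open RawMonoidDefs +-rawMonoid public
    using (sum)

------------------------------------------------------------------------
-- Programs for a random access machine with integer and real storage

-- Registers are named by literals, so a program uses a number of registers
-- that is independent of its input; unbounded storage is only available
-- through heap cells, which have computed addresses.  The inputs n and p and
-- the n points are read-only.

infix  4 _<ᴵ_ _<ᴿ_
infixl 6 _+ᴵ_ _∸ᴵ_ _+ᴿ_ _-ᴿ_
infixl 7 _*ᴵ_ _*ᴿ_ _/ᴿ_
infix  3 _≔ᴵ_ _≔ᴿ_ cellᴵ_≔_ cellᴿ_≔_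
infixr 2 _⨾_

data IExp : Set where
  litᴵ                : ℕ → IExp
  inputN inputP       : IExp
  regᴵ                : ℕ → IExp
  cellᴵ               : IExp → IExp
  _+ᴵ_ _∸ᴵ_ _*ᴵ_      : IExp → IExp → IExp

data RExp : Set where
  0ᴿ 1ᴿ               : RExp
  regᴿ                : ℕ → RExp
  cellᴿ               : IExp → RExp
  coord¹ coord²       : IExp → RExp
  dissim              : IExp → IExp → RExp
  _+ᴿ_ _-ᴿ_ _*ᴿ_ _/ᴿ_ : RExp → RExp → RExp

data BExp : Set where
  _<ᴵ_ : IExp → IExp → BExp
  _<ᴿ_ : RExp → RExp → BExp

data Program : Set where
  skip            : Program
  _≔ᴵ_            : ℕ → IExp → Program
  _≔ᴿ_            : ℕ → RExp → Program
  cellᴵ_≔_        : IExp → IExp → Program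
  cellᴿ_≔_        : IExp → RExp → Program
  _⨾_             : Program → Program → Program
  if_then_else_fi : BExp → Program → Program → Program
  while_loop_end     : BExp → Program → Program

-- The time to evaluate an expression is its number of nodes.

timeᴵ : IExp → ℕ
timeᴵ (litᴵ _)  = 1
timeᴵ inputN    = 1
timeᴵ inputP    = 1
timeᴵ (regᴵ _)  = 1
timeᴵ (cellᴵ e) = 1 ℕ.+ timeᴵ e
timeᴵ (e +ᴵ f)  = 1 ℕ.+ timeᴵ e ℕ.+ timeᴵ f
timeᴵ (e ∸ᴵ f)  = 1 ℕ.+ timeᴵ e ℕ.+ timeᴵ f
timeᴵ (e *ᴵ f)  = 1 ℕ.+ timeᴵ e ℕ.+ timeᴵ f

timeᴿ : RExp → ℕ
timeᴿ 0ᴿ           = 1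
timeᴿ 1ᴿ           = 1
timeᴿ (regᴿ _)     = 1
timeᴿ (cellᴿ e)    = 1 ℕ.+ timeᴵ e
timeᴿ (coord¹ e)   = 1 ℕ.+ timeᴵ e
timeᴿ (coord² e)   = 1 ℕ.+ timeᴵ e
timeᴿ (dissim e f) = 1 ℕ.+ timeᴵ e ℕ.+ timeᴵ f
timeᴿ (e +ᴿ f)     = 1 ℕ.+ timeᴿ e ℕ.+ timeᴿ f
timeᴿ (e -ᴿ f)     = 1 ℕ.+ timeᴿ e ℕ.+ timeᴿ f
timeᴿ (e *ᴿ f)     = 1 ℕ.+ timeᴿ e ℕ.+ timeᴿ f
timeᴿ (e /ᴿ f)     = 1 ℕ.+ timeᴿ e ℕ.+ timeᴿ f

timeᴮ : BExp → ℕ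
timeᴮ (e <ᴵ f) = 1 ℕ.+ timeᴵ e ℕ.+ timeᴵ f
timeᴮ (e <ᴿ f) = 1 ℕ.+ timeᴿ e ℕ.+ timeᴿ f

infixl 9 _[_↦_]

_[_↦_] : {A : Set} → (ℕ → A) → ℕ → A → ℕ → A
(m [ k ↦ a ]) l = if l ≡ᵇ k then a else m l

------------------------------------------------------------------------
-- Points, dissimilarities, and the p-dispersion problem

module Dispersion (𝓡 : RealNumbers) (α : RealNumbers.ℝ 𝓡) where

  open RealNumbers 𝓡

  Point : Set
  Point = ℝ × ℝ

  infix 4 _≺_ _𝓘_

  _≺_ : Point → Point → Set
  (y¹ , y²) ≺ (z¹ , z²) = y¹ < z¹ × z² < y²

  _𝓘_ : Point → Point → Set
  y 𝓘 z = y ≺ z ⊎ z ≺ y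

  dist : Point → Point → ℝ
  dist (y¹ , y²) (z¹ , z²) =
    sqrt ((y¹ - z¹) * (y¹ - z¹) + (y² - z²) * (y² - z²))

  distᵅ : Point → Point → ℝ
  distᵅ y z = dist y z ^ʳ α

  IsSelection : ∀ {n p} → (Fin p → Fin n) → Set
  IsSelection i = ∀ {j k} → j Fin.< k → i j Fin.< i k

  value : ∀ {n p} → (Fin n → Point) → (Fin p → Fin n) → ℝ
  value {p = zero}  x i = 0#
  value {p = suc q} x i =
    sum {q} λ j → distᵅ (x (i (inject₁ j))) (x (i (Fin.suc j)))

  IsOptimal : ∀ {n p} → (Fin n → Point) → (Fin p → Fin n) → Set
  IsOptimal {n} {p} x i =
    IsSelection i ×
    (∀ (i′ : Fin p → Fin n) → IsSelection i′ → value x i′ ≤ value x i)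

  -- x is the indexing of E by increasing first coordinate; π is the order in
  -- which E is presented to the algorithm, which need not be sorted.
  record Instance (n p : ℕ) : Set where
    field
      2≤p    : 2 ℕ.≤ p
      p≤n    : p ℕ.≤ n
      x      : Fin n → Point
      front  : ∀ {i j} → i ≢ j → x i 𝓘 x j
      sorted : ∀ {i j} → i Fin.< j → proj₁ (x i) < proj₁ (x j)
      π      : Permutation′ n

    -- Reading past the end of the input yields the origin.
    input : ℕ → Point
    input k with k ℕ.<? n
    ... | yes k<n = x (π ⟨$⟩ʳ fromℕ< k<n)
    ... | no  _   = 0# , 0#

  ----------------------------------------------------------------------
  -- Semantics of programs

  record State : Set where
    constructor state
    field
      iregs  : ℕ → ℕ
      rregs  : ℕ → ℝ
      icells : ℕ → ℕ
      rcells : ℕ → ℝ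

  open State public

  module Execution {n p : ℕ} (I : Instance n p) where

    open Instance I

    evalᴵ : IExp → State → ℕ
    evalᴵ (litᴵ k)  σ = k
    evalᴵ inputN    σ = n
    evalᴵ inputP    σ = p
    evalᴵ (regᴵ r)  σ = iregs σ r
    evalᴵ (cellᴵ e) σ = icells σ (evalᴵ e σ)
    evalᴵ (e +ᴵ f)  σ = evalᴵ e σ ℕ.+ evalᴵ f σ
    evalᴵ (e ∸ᴵ f)  σ = evalᴵ e σ ℕ.∸ evalᴵ f σ
    evalᴵ (e *ᴵ f)  σ = evalᴵ e σ ℕ.* evalᴵ f σ

    evalᴿ : RExp → State → ℝ
    evalᴿ 0ᴿ           σ = 0#
    evalᴿ 1ᴿ           σ = 1#
    evalᴿ (regᴿ r)     σ = rregs σ r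
    evalᴿ (cellᴿ e)    σ = rcells σ (evalᴵ e σ)
    evalᴿ (coord¹ e)   σ = proj₁ (input (evalᴵ e σ))
    evalᴿ (coord² e)   σ = proj₂ (input (evalᴵ e σ))
    evalᴿ (dissim e f) σ = distᵅ (input (evalᴵ e σ)) (input (evalᴵ f σ))
    evalᴿ (e +ᴿ f)     σ = evalᴿ e σ + evalᴿ f σ
    evalᴿ (e -ᴿ f)     σ = evalᴿ e σ - evalᴿ f σ
    evalᴿ (e *ᴿ f)     σ = evalᴿ e σ * evalᴿ f σ
    evalᴿ (e /ᴿ f)     σ = evalᴿ e σ * evalᴿ f σ ⁻¹

    evalᴮ : BExp → State → Bool
    evalᴮ (e <ᴵ f) σ = ⌊ evalᴵ e σ ℕ.<? evalᴵ f σ ⌋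
    evalᴮ (e <ᴿ f) σ = ⌊ evalᴿ e σ <? evalᴿ f σ ⌋

    -- Big-step execution, c , σ ⇓[ t ] σ′ meaning that c run from σ halts in
    -- σ′ after t time units, on a machine having only `space` heap cells of
    -- each kind and integer words limited to values up to `word`.  The word
    -- limit prevents large amounts of data from being packed into one integer.
    module Run (space word : ℕ) where

      infix 3 _,_⇓[_]_

      data _,_⇓[_]_ : Program → State → ℕ → State → Set where

        ⇓skip : ∀ {σ} → skip , σ ⇓[ 1 ] σ

        ⇓regᴵ : ∀ {σ r e} →
          evalᴵ e σ ℕ.≤ word →
          (r ≔ᴵ e) , σ ⇓[ suc (timeᴵ e) ]
            record σ { iregs = iregs σ [ r ↦ evalᴵ e σ ] }

        ⇓regᴿ : ∀ {σ r e} →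
          (r ≔ᴿ e) , σ ⇓[ suc (timeᴿ e) ]
            record σ { rregs = rregs σ [ r ↦ evalᴿ e σ ] }

        ⇓cellᴵ : ∀ {σ a e} →
          evalᴵ a σ ℕ.< space → evalᴵ e σ ℕ.≤ word →
          (cellᴵ a ≔ e) , σ ⇓[ suc (timeᴵ a ℕ.+ timeᴵ e) ]
            record σ { icells = icells σ [ evalᴵ a σ ↦ evalᴵ e σ ] }

        ⇓cellᴿ : ∀ {σ a e} →
          evalᴵ a σ ℕ.< space →
          (cellᴿ a ≔ e) , σ ⇓[ suc (timeᴵ a ℕ.+ timeᴿ e) ]
            record σ { rcells = rcells σ [ evalᴵ a σ ↦ evalᴿ e σ ] }

        ⇓seq : ∀ {c d σ σ′ σ″ s t} →
          c , σ ⇓[ s ] σ′ → d , σ′ ⇓[ t ] σ″ →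
          (c ⨾ d) , σ ⇓[ s ℕ.+ t ] σ″

        ⇓ifᵗ : ∀ {b c d σ σ′ t} →
          evalᴮ b σ ≡ true → c , σ ⇓[ t ] σ′ →
          if b then c else d fi , σ ⇓[ suc (timeᴮ b ℕ.+ t) ] σ′

        ⇓ifᶠ : ∀ {b c d σ σ′ t} →
          evalᴮ b σ ≡ false → d , σ ⇓[ t ] σ′ →
          if b then c else d fi , σ ⇓[ suc (timeᴮ b ℕ.+ t) ] σ′

        ⇓whileᵗ : ∀ {b c σ σ′ σ″ s t} →
          evalᴮ b σ ≡ true → c , σ ⇓[ s ] σ′ →
          while b loop c end , σ′ ⇓[ t ] σ″ →
          while b loop c end , σ ⇓[ suc (timeᴮ b ℕ.+ s ℕ.+ t) ] σ″

        ⇓whileᶠ : ∀ {b c σ} →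
          evalᴮ b σ ≡ false →
          while b loop c end , σ ⇓[ suc (timeᴮ b) ] σ

    -- The answer consists of the optimal value in real register 0 and, in
    -- integer cells 0, …, p-1, the input positions of the points
    -- x (i 0), …, x (i (p-1)) of an optimal selection i.
    IsAnswer : State → Set
    IsAnswer σ = ∃[ i ] IsOptimal x i
                      × rregs σ 0 ≡ value x i
                      × (∀ (j : Fin p) → icells σ (toℕ j) ≡ toℕ (π ⟨$⟩ˡ i j))

  -- The initial contents of the memory are arbitrary, so reading cells that
  -- have not been written, in particular cells beyond `space`, is of no use.
  _solves_inTime_inSpace_withWords_ : ∀ {n p} → Program → Instance n p → (time space word : ℕ) → Set
  c solves I inTime time inSpace space withWords word =
    ∀ σ → ∃[ t ] ∃[ σ′ ] (c , σ ⇓[ t ] σ′) × t ℕ.≤ time × IsAnswer σ′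
    where
      open Execution I
      open Run space word

{-# OPTIONS --safe #-}
module Submission where

open import Defs
open import Data.Nat using (ℕ; _*_; _^_; _<_)
open import Data.Product using (_×_; ∃-syntax)
open import Data.Sum using (_⊎_)
open import Relation.Binary.PropositionalEquality using (_≡_)

-- For points of a Pareto front ordered by first coordinate, the distance of a
-- pair only grows when the pair is spread outwards.  So some optimal selection
-- starts at the point with least first coordinate, and for p = 2 and p = 3 it
-- also ends at the other extreme, which leaves at most one point to search for.
-- In general the best value of k + 2 points starting at a is the maximum over
-- the later points b of d(a, b) plus the best value of k + 1 points starting at
-- b.  As b ranges over the whole input and is compared with a directly, the
-- points need not be sorted.  One search takes O(n), a row of the table O(n²).

import Algebra.Properties.AbelianGroup as AbelianGroupProperties
import Algebra.Properties.Group as GroupProperties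
import Algebra.Properties.Ring as RingProperties
import Relation.Binary.Construct.StrictToNonStrict as NonStrict
open import Algebra.Bundles using (CommutativeRing)
open import Data.Bool using (Bool; true; false; T)
open import Data.Fin as Fin using (Fin; toℕ; fromℕ<; inject≤)
import Data.Fin.Properties as Fin
open import Data.Fin.Permutation using (_⟨$⟩ʳ_; _⟨$⟩ˡ_; inverseˡ; inverseʳ)
open import Data.Nat as ℕ using (zero; suc; _≤_; z≤n; s≤s; NonZero)
import Data.Nat.Properties as ℕ
open import Data.Product using (Σ-syntax; _,_; proj₁; proj₂)
open import Data.Sum using (inj₁; inj₂)
open import Data.Unit using (tt)
open import Relation.Binary.Definitions using (tri<; tri≈; tri>)
open import Relation.Binary.PropositionalEquality
  using (refl; sym; trans; cong; cong₂; subst; subst₂; module ≡-Reasoning)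
open import Relation.Binary.Structures using (IsStrictTotalOrder; IsTotalOrder)
open import Relation.Nullary using (Dec; ¬_; yes; no; contradiction)
open import Relation.Nullary.Decidable using (⌊_⌋)

-- Not every point starts a selection of the required length, so a table entry must be able to say
-- that there is none. Values are nonnegative, hence `-1` is free for this purpose and one
-- comparison tests feasibility. Indexing the table by the starting point pays off twice: of the
-- last row only the entry of the first point matters, and the trace, descending one row per step,
-- meets the selected points in increasing order. All searches are instances of one program, with
-- the feasibility test and the value of the tail as parameters, so the scan is verified once.
-- Running times are bounded by `M * work c`, where `work c` depends on the text of the program
-- alone and nested loops multiply their iteration bounds into `M`. The constants of the theorem are
-- therefore `work` of whole programs, and only the multipliers have to be compared with `n` and
-- `p * n ^ 2`.

⌊⌋-true : ∀ {A : Set} (A? : Dec A) → A → ⌊ A? ⌋ ≡ true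
⌊⌋-true (yes _) _ = refl
⌊⌋-true (no ¬a) a = contradiction a ¬a

⌊⌋-false : ∀ {A : Set} (A? : Dec A) → ¬ A → ⌊ A? ⌋ ≡ false
⌊⌋-false (yes a) ¬a = contradiction a ¬a
⌊⌋-false (no _)  _  = refl

⌊⌋-true⁻¹ : ∀ {A : Set} (A? : Dec A) → ⌊ A? ⌋ ≡ true → A
⌊⌋-true⁻¹ (yes a) _ = a

⌊⌋-false⁻¹ : ∀ {A : Set} (A? : Dec A) → ⌊ A? ⌋ ≡ false → ¬ A
⌊⌋-false⁻¹ (no ¬a) _ = ¬a

-- Order properties of squares, square roots, inverses and real powers

module OrderedField (𝓡 : RealNumbers) where

  open RealNumbers 𝓡 renaming (_*_ to _·_; _<_ to _<ʳ_; _≤_ to _≤ʳ_)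
  open CommutativeRing commutativeRing public
    using (+-comm; +-identityˡ; -‿inverseʳ;
           *-comm; *-assoc; *-identityˡ; *-identityʳ; zeroʳ)
  open RingProperties (CommutativeRing.ring commutativeRing)
    using (-‿distribˡ-*; -‿distribʳ-*; -‿involutive; x[y-z]≈xy-xz)
  open GroupProperties (CommutativeRing.+-group commutativeRing)
    using (//-rightDividesˡ)
  open AbelianGroupProperties (CommutativeRing.+-abelianGroup commutativeRing)
    using (⁻¹-anti-homo‿-)

  open IsStrictTotalOrder isStrictTotalOrder public
    using () renaming (trans to <ʳ-trans; irrefl to <ʳ-irrefl; asym to <ʳ-asym)
  open IsTotalOrder (NonStrict.isTotalOrder _≡_ _<ʳ_ isStrictTotalOrder) public
    using () renaming (trans to ≤ʳ-trans; antisym to ≤ʳ-antisym)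

  ≤ʳ-refl : ∀ {x} → x ≤ʳ x
  ≤ʳ-refl = inj₂ refl

  <-≤-transʳ : ∀ {x y z} → x <ʳ y → y ≤ʳ z → x <ʳ z
  <-≤-transʳ x<y (inj₁ y<z)  = <ʳ-trans x<y y<z
  <-≤-transʳ x<y (inj₂ refl) = x<y

  ≤-<-transʳ : ∀ {x y z} → x ≤ʳ y → y <ʳ z → x <ʳ z
  ≤-<-transʳ (inj₁ x<y)  y<z = <ʳ-trans x<y y<z
  ≤-<-transʳ (inj₂ refl) y<z = y<z

  ≮⇒≥ʳ : ∀ {x y} → ¬ x <ʳ y → y ≤ʳ x
  ≮⇒≥ʳ {x} {y} x≮y with compare x y
  ... | tri< x<y _ _ = contradiction x<y x≮y
  ... | tri≈ _ x≡y _ = inj₂ (sym x≡y)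
  ... | tri> _ _ y<x = inj₁ y<x

  ≤⇒≯ʳ : ∀ {x y} → x ≤ʳ y → ¬ y <ʳ x
  ≤⇒≯ʳ x≤y y<x = <ʳ-irrefl refl (≤-<-transʳ x≤y y<x)

  +-monoˡ-≤ʳ : ∀ z {x y} → x ≤ʳ y → x + z ≤ʳ y + z
  +-monoˡ-≤ʳ z (inj₁ x<y)  = inj₁ (+-monoˡ-< z x<y)
  +-monoˡ-≤ʳ z (inj₂ refl) = ≤ʳ-refl

  +-monoʳ-≤ʳ : ∀ z {x y} → x ≤ʳ y → z + x ≤ʳ z + y
  +-monoʳ-≤ʳ z {x} {y} x≤y = subst₂ _≤ʳ_ (+-comm x z) (+-comm y z) (+-monoˡ-≤ʳ z x≤y)

  +-mono-≤ʳ : ∀ {w x y z} → w ≤ʳ x → y ≤ʳ z → w + y ≤ʳ x + z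
  +-mono-≤ʳ {x = x} {y = y} w≤x y≤z = ≤ʳ-trans (+-monoˡ-≤ʳ y w≤x) (+-monoʳ-≤ʳ x y≤z)

  +-mono-<ʳ : ∀ {w x y z} → w <ʳ x → y <ʳ z → w + y <ʳ x + z
  +-mono-<ʳ {x = x} {y = y} w<x y<z = <-≤-transʳ (+-monoˡ-< y w<x) (+-monoʳ-≤ʳ x (inj₁ y<z))

  +-nonneg : ∀ {x y} → 0# ≤ʳ x → 0# ≤ʳ y → 0# ≤ʳ x + y
  +-nonneg {x} {y} 0≤x 0≤y = subst (_≤ʳ x + y) (+-identityˡ 0#) (+-mono-≤ʳ 0≤x 0≤y)

  <⇒0<- : ∀ {x y} → x <ʳ y → 0# <ʳ y - x
  <⇒0<- {x} {y} x<y = subst (_<ʳ y - x) (-‿inverseʳ x) (+-monoˡ-< (- x) x<y)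

  0<-⇒< : ∀ {x y} → 0# <ʳ y - x → x <ʳ y
  0<-⇒< {x} {y} 0<y-x = subst₂ _<ʳ_ (+-identityˡ x) (//-rightDividesˡ x y) (+-monoˡ-< x 0<y-x)

  -1<0 : 0# - 1# <ʳ 0#
  -1<0 = subst (0# - 1# <ʳ_) (-‿inverseʳ 1#) (+-monoˡ-< (- 1#) 0<1)

  neg-swap : ∀ x y → x - y ≡ - (y - x)
  neg-swap x y = sym (⁻¹-anti-homo‿- y x)

  -‿monoʳ-< : ∀ {x y} z → x <ʳ y → z - y <ʳ z - x
  -‿monoʳ-< {x} {y} z x<y = subst₂ _<ʳ_ (+-comm (- y) z) (+-comm (- x) z)
    (+-monoˡ-< z (0<-⇒< (subst (0# <ʳ_) eq (<⇒0<- x<y))))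
    where
    eq : y - x ≡ - x - (- y)
    eq = trans (+-comm y (- x)) (cong (- x +_) (sym (-‿involutive y)))

  neg-sq : ∀ x → - x · - x ≡ x · x
  neg-sq x = begin
    - x · - x     ≡⟨ sym (-‿distribˡ-* x (- x)) ⟩
    - (x · - x)   ≡⟨ cong -_ (sym (-‿distribʳ-* x x)) ⟩
    - - (x · x)   ≡⟨ -‿involutive (x · x) ⟩
    x · x         ∎
    where open ≡-Reasoning

  sq-swap : ∀ x y → (x - y) · (x - y) ≡ (y - x) · (y - x)
  sq-swap x y = trans (cong (λ z → z · z) (neg-swap x y)) (neg-sq (y - x))

  *-monoʳ-<ʳ : ∀ {z x y} → 0# <ʳ z → x <ʳ y → z · x <ʳ z · y
  *-monoʳ-<ʳ {z} {x} {y} 0<z x<y = 0<-⇒< (subst (0# <ʳ_) (x[y-z]≈xy-xz z y x) (*-pos 0<z (<⇒0<- x<y)))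

  *-monoˡ-<ʳ : ∀ {z x y} → 0# <ʳ z → x <ʳ y → x · z <ʳ y · z
  *-monoˡ-<ʳ {z} {x} {y} 0<z x<y = subst₂ _<ʳ_ (*-comm z x) (*-comm z y) (*-monoʳ-<ʳ 0<z x<y)

  sq-mono-< : ∀ {x y} → 0# <ʳ x → x <ʳ y → x · x <ʳ y · y
  sq-mono-< 0<x x<y = <ʳ-trans (*-monoʳ-<ʳ 0<x x<y) (*-monoˡ-<ʳ (<ʳ-trans 0<x x<y) x<y)

  sq-mono-≤ : ∀ {x y} → 0# ≤ʳ x → x ≤ʳ y → x · x ≤ʳ y · y
  sq-mono-≤ 0≤x           (inj₂ refl) = ≤ʳ-refl
  sq-mono-≤ (inj₁ 0<x)    (inj₁ x<y)  = inj₁ (sq-mono-< 0<x x<y)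
  sq-mono-≤ {y = y} (inj₂ refl) (inj₁ 0<y) =
    subst (_≤ʳ y · y) (sym (zeroʳ 0#)) (inj₁ (*-pos 0<y 0<y))

  sqrt-pos : ∀ {x} → 0# <ʳ x → 0# <ʳ sqrt x
  sqrt-pos {x} 0<x with sqrt-≥ (inj₁ 0<x)
  ... | inj₁ 0<√x = 0<√x
  ... | inj₂ 0≡√x = contradiction 0<x (<ʳ-irrefl
        (trans (sym (zeroʳ 0#)) (trans (cong (λ z → z · z) 0≡√x) (sqrt-* (inj₁ 0<x)))))

  -- Squaring undoes `sqrt` and preserves `≤` on nonnegative reals, so roots in the wrong order
  -- would contradict `x < y`.
  sqrt-mono-< : ∀ {x y} → 0# <ʳ x → x <ʳ y → sqrt x <ʳ sqrt y
  sqrt-mono-< {x} {y} 0<x x<y with sqrt x <? sqrt y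
  ... | yes √x<√y = √x<√y
  ... | no  √x≮√y = contradiction x<y (≤⇒≯ʳ (subst₂ _≤ʳ_ (sqrt-* 0≤y) (sqrt-* (inj₁ 0<x))
        (sq-mono-≤ (sqrt-≥ 0≤y) (≮⇒≥ʳ √x≮√y))))
    where
    0≤y = inj₁ (<ʳ-trans 0<x x<y)

  pos⇒≢0 : ∀ {x} → 0# <ʳ x → ¬ x ≡ 0#
  pos⇒≢0 0<x x≡0 = <ʳ-irrefl (sym x≡0) 0<x

  ⁻¹-pos : ∀ {x} → 0# <ʳ x → 0# <ʳ x ⁻¹
  ⁻¹-pos {x} 0<x with compare 0# (x ⁻¹)
  ... | tri< 0<x⁻¹ _ _ = 0<x⁻¹
  ... | tri≈ _ 0≡x⁻¹ _ = contradiction 0<1 (<ʳ-irrefl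
        (trans (sym (zeroʳ x)) (trans (cong (x ·_) 0≡x⁻¹) (*-inverseʳ (pos⇒≢0 0<x)))))
  ... | tri> _ _ x⁻¹<0 = contradiction 0<1
        (<ʳ-asym (subst₂ _<ʳ_ (*-inverseʳ (pos⇒≢0 0<x)) (zeroʳ x) (*-monoʳ-<ʳ 0<x x⁻¹<0)))

  -- Since `0# + 0#` is `0#`, the power `e` satisfies `e · e ≡ e`, and it can be cancelled because
  -- it is positive.
  ^ʳ-0 : ∀ {x} → 0# <ʳ x → x ^ʳ 0# ≡ 1#
  ^ʳ-0 {x} 0<x = begin
    e               ≡⟨ sym (*-identityʳ e) ⟩
    e · 1#          ≡⟨ cong (e ·_) (sym e·e⁻¹) ⟩
    e · (e · e ⁻¹)  ≡⟨ sym (*-assoc e e (e ⁻¹)) ⟩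
    e · e · e ⁻¹    ≡⟨ cong (_· e ⁻¹) (sym (^ʳ-+ 0# 0# 0<x)) ⟩
    (x ^ʳ (0# + 0#)) · e ⁻¹ ≡⟨ cong (λ a → x ^ʳ a · e ⁻¹) (+-identityˡ 0#) ⟩
    e · e ⁻¹        ≡⟨ e·e⁻¹ ⟩
    1#              ∎
    where
    open ≡-Reasoning
    e = x ^ʳ 0#
    e·e⁻¹ : e · e ⁻¹ ≡ 1#
    e·e⁻¹ = *-inverseʳ (pos⇒≢0 (^ʳ-pos 0# 0<x))

  -- The axioms give monotonicity in the exponent only; write y = (y/x) x.
  ^ʳ-monoˡ-< : ∀ {a x y} → 0# <ʳ a → 0# <ʳ x → x <ʳ y → x ^ʳ a <ʳ y ^ʳ a
  ^ʳ-monoˡ-< {a} {x} {y} 0<a 0<x x<y =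
    -- The ratio `r` exceeds `1#`, so `r ^ʳ a` exceeds `r ^ʳ 0#`, which is `1#`; multiply by
    -- `x ^ʳ a`.
    subst₂ _<ʳ_ (*-identityˡ (x ^ʳ a)) (trans (sym (^ʳ-distrib-* a 0<r 0<x)) (cong (_^ʳ a) r·x≡y))
      (*-monoˡ-<ʳ (^ʳ-pos a 0<x) (subst (_<ʳ r ^ʳ a) (^ʳ-0 0<r) (^ʳ-mono-< 1<r 0<a)))
    where
    open ≡-Reasoning
    r = y · x ⁻¹
    1<r : 1# <ʳ r
    1<r = subst (_<ʳ r) (*-inverseʳ (pos⇒≢0 0<x)) (*-monoˡ-<ʳ (⁻¹-pos 0<x) x<y)
    0<r : 0# <ʳ r
    0<r = <ʳ-trans 0<1 1<r
    r·x≡y : r · x ≡ y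
    r·x≡y = begin
      y · x ⁻¹ · x   ≡⟨ *-assoc y (x ⁻¹) x ⟩
      y · (x ⁻¹ · x) ≡⟨ cong (y ·_) (trans (*-comm (x ⁻¹) x) (*-inverseʳ (pos⇒≢0 0<x))) ⟩
      y · 1#         ≡⟨ *-identityʳ y ⟩
      y              ∎

-- Strict growth of the dissimilarity along a Pareto front

module Distance (𝓡 : RealNumbers) (α : RealNumbers.ℝ 𝓡)
                (0<α : RealNumbers._<_ 𝓡 (RealNumbers.0# 𝓡) α) where

  open RealNumbers 𝓡 renaming (_*_ to _·_; _<_ to _<ʳ_; _≤_ to _≤ʳ_)
  open OrderedField 𝓡
  open Dispersion 𝓡 α

  private
    sq : ℝ → ℝ → ℝ
    sq a b = (a - b) · (a - b)

    sq-pos : ∀ {a b} → a <ʳ b → 0# <ʳ sq a b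
    sq-pos {a} {b} a<b =
      subst (0# <ʳ_) (sq-swap b a) (*-pos (<⇒0<- a<b) (<⇒0<- a<b))

    sq-growʳ : ∀ {a b c} → a <ʳ b → b <ʳ c → sq a b <ʳ sq a c
    sq-growʳ {a} {b} {c} a<b b<c = subst₂ _<ʳ_ (sq-swap b a) (sq-swap c a)
      (sq-mono-< (<⇒0<- a<b) (+-monoˡ-< (- a) b<c))

    sq-growˡ : ∀ {a b c} → a <ʳ b → b <ʳ c → sq b c <ʳ sq a c
    sq-growˡ {a} {b} {c} a<b b<c = subst₂ _<ʳ_ (sq-swap c b) (sq-swap c a)
      (sq-mono-< (<⇒0<- b<c) (-‿monoʳ-< c a<b))

    sum-sq-pos : ∀ {y z} → y ≺ z →
                 0# <ʳ sq (proj₁ y) (proj₁ z) + sq (proj₂ y) (proj₂ z)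
    sum-sq-pos {y¹ , y²} {z¹ , z²} (y¹<z¹ , z²<y²) =
      subst (_<ʳ sq y¹ z¹ + sq y² z²) (+-identityˡ 0#)
        (+-mono-<ʳ (sq-pos y¹<z¹) (subst (0# <ʳ_) (sq-swap z² y²) (sq-pos z²<y²)))

    -- The hypothesis `y ≺ z` makes the smaller sum of squares positive, as the monotonicity of
    -- `sqrt` and of the power requires.
    distᵅ-mono : ∀ {y z v w} → y ≺ z →
                 sq (proj₁ y) (proj₁ z) <ʳ sq (proj₁ v) (proj₁ w) →
                 sq (proj₂ y) (proj₂ z) <ʳ sq (proj₂ v) (proj₂ w) →
                 distᵅ y z <ʳ distᵅ v w
    distᵅ-mono y≺z lt¹ lt² = ^ʳ-monoˡ-< 0<α (sqrt-pos (sum-sq-pos y≺z))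
                               (sqrt-mono-< (sum-sq-pos y≺z) (+-mono-<ʳ lt¹ lt²))

  distᵅ-pos : ∀ {y z} → y ≺ z → 0# <ʳ distᵅ y z
  distᵅ-pos y≺z = ^ʳ-pos α (sqrt-pos (sum-sq-pos y≺z))

  distᵅ-growʳ : ∀ {y z w} → y ≺ z → z ≺ w → distᵅ y z <ʳ distᵅ y w
  distᵅ-growʳ {y} {z} {w} y≺z z≺w = distᵅ-mono {v = y} {w} y≺z
    (sq-growʳ (proj₁ y≺z) (proj₁ z≺w))
    -- Second coordinates run backwards along the front, so here the interval grows at its lower
    -- end.
    (subst₂ _<ʳ_ (sq-swap _ _) (sq-swap _ _) (sq-growˡ (proj₂ z≺w) (proj₂ y≺z)))

  distᵅ-growˡ : ∀ {y z w} → y ≺ z → z ≺ w → distᵅ z w <ʳ distᵅ y w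
  distᵅ-growˡ {y} {z} {w} y≺z z≺w = distᵅ-mono {v = y} {w} z≺w
    (sq-growˡ (proj₁ y≺z) (proj₁ z≺w))
    (subst₂ _<ʳ_ (sq-swap _ _) (sq-swap _ _) (sq-growʳ (proj₂ z≺w) (proj₂ y≺z)))

-- Registers and programs

-- The first five are integer registers, ordered so that a search overwrites only those below 2 and
-- `findMin` only those below 3. `out` and `best` are real registers; the answer is read from real
-- register 0.
cand arg src base layer out best : ℕ
cand  = 0
arg   = 1
src   = 2
base  = 3
layer = 4
out   = 0
best  = 1

-- A candidate is feasible if it passes the test F, and then T is the value of
-- what follows it; both refer to the candidate in register cand.
improve : BExp → RExp → Program
improve F T =
  if coord¹ (regᴵ src) <ᴿ coord¹ (regᴵ cand) then
    if F then
      if regᴿ best <ᴿ dissim (regᴵ src) (regᴵ cand) +ᴿ T then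
        best ≔ᴿ dissim (regᴵ src) (regᴵ cand) +ᴿ T ⨾
        arg ≔ᴵ regᴵ cand
      else skip fi
    else skip fi
  else skip fi

search : BExp → RExp → Program
search F T =
  -- In all uses feasible candidates have nonnegative values, so the first one replaces `-1`, which
  -- survives only if there is none.
  best ≔ᴿ 0ᴿ -ᴿ 1ᴿ ⨾
  cand ≔ᴵ litᴵ 0 ⨾
  while regᴵ cand <ᴵ inputN loop
    improve F T ⨾
    cand ≔ᴵ regᴵ cand +ᴵ litᴵ 1
  end

replaceMin : Program
replaceMin =
  if coord¹ (regᴵ cand) <ᴿ coord¹ (regᴵ src) then
    src ≔ᴵ regᴵ cand
  else skip fi

findMin : Program
findMin =
  src ≔ᴵ litᴵ 0 ⨾
  cand ≔ᴵ litᴵ 0 ⨾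
  while regᴵ cand <ᴵ inputN loop
    replaceMin ⨾
    cand ≔ᴵ regᴵ cand +ᴵ litᴵ 1
  end

always : BExp
always = litᴵ 0 <ᴵ litᴵ 1

twoPoints : Program
twoPoints =
  findMin ⨾
  search always 0ᴿ ⨾
  out ≔ᴿ regᴿ best ⨾
  cellᴵ litᴵ 0 ≔ regᴵ src ⨾
  cellᴵ litᴵ 1 ≔ regᴵ arg

-- The first search finds a point farthest from the first one, which is the
-- last one by Pareto monotonicity; it is kept in base.
threePoints : Program
threePoints =
  findMin ⨾
  search always 0ᴿ ⨾
  base ≔ᴵ regᴵ arg ⨾
  -- The summand `0ᴿ` is the value of the trivial path at the last point; it gives the total the
  -- form of the value of a `Path`.
  search (coord¹ (regᴵ cand) <ᴿ coord¹ (regᴵ base)) (dissim (regᴵ cand) (regᴵ base) +ᴿ 0ᴿ) ⨾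
  out ≔ᴿ regᴿ best ⨾
  cellᴵ litᴵ 0 ≔ regᴵ src ⨾
  cellᴵ litᴵ 1 ≔ regᴵ arg ⨾
  cellᴵ litᴵ 2 ≔ regᴵ base

-- Real cell k * n + j holds the best value of k + 1 points starting at the
-- j-th input point, or -1 if there is no such selection; base is the address
-- of a row.
searchRow : Program
searchRow = search (0ᴿ -ᴿ 1ᴿ <ᴿ cellᴿ (regᴵ base +ᴵ regᴵ cand)) (cellᴿ (regᴵ base +ᴵ regᴵ cand))

firstRow : Program
firstRow =
  src ≔ᴵ litᴵ 0 ⨾
  while regᴵ src <ᴵ inputN loop
    cellᴿ regᴵ src ≔ 0ᴿ ⨾
    src ≔ᴵ regᴵ src +ᴵ litᴵ 1
  end

nextRow : Program
nextRow =
  src ≔ᴵ litᴵ 0 ⨾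
  while regᴵ src <ᴵ inputN loop
    searchRow ⨾
    -- `base` still addresses the row being read. With `inputN` in front, the address matches the
    -- unfolding of `suc k * n`.
    cellᴿ inputN +ᴵ regᴵ base +ᴵ regᴵ src ≔ regᴿ best ⨾
    src ≔ᴵ regᴵ src +ᴵ litᴵ 1
  end

fillTable : Program
fillTable =
  firstRow ⨾
  base ≔ᴵ litᴵ 0 ⨾
  layer ≔ᴵ litᴵ 1 ⨾
  while regᴵ layer <ᴵ inputP loop
    nextRow ⨾
    base ≔ᴵ inputN +ᴵ regᴵ base ⨾
    layer ≔ᴵ regᴵ layer +ᴵ litᴵ 1
  end

traceStep : Program
traceStep =
  -- The table has been left with `base` at its last row; the next point continues a path shorter by
  -- one, hence one row lower.
  base ≔ᴵ regᴵ base ∸ᴵ inputN ⨾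
  searchRow ⨾
  src ≔ᴵ regᴵ arg ⨾
  cellᴵ regᴵ layer ≔ regᴵ arg ⨾
  layer ≔ᴵ regᴵ layer +ᴵ litᴵ 1

-- No predecessors are stored: the trace repeats the searches.
dynamicProgram : Program
dynamicProgram =
  fillTable ⨾
  findMin ⨾
  out ≔ᴿ cellᴿ (regᴵ base +ᴵ regᴵ src) ⨾
  cellᴵ litᴵ 0 ≔ regᴵ src ⨾
  layer ≔ᴵ litᴵ 1 ⨾
  while regᴵ layer <ᴵ inputP loop traceStep end

-- Every loop is charged for a single iteration; Runs multiplies the result by
-- a bound on the iterations.
work : Program → ℕ
work skip                    = 1
work (r ≔ᴵ e)                = suc (timeᴵ e)
work (r ≔ᴿ e)                = suc (timeᴿ e)
work (cellᴵ a ≔ e)           = suc (timeᴵ a ℕ.+ timeᴵ e)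
work (cellᴿ a ≔ e)           = suc (timeᴵ a ℕ.+ timeᴿ e)
work (c ⨾ d)                 = work c ℕ.+ work d
work (if b then c else d fi) = suc (timeᴮ b) ℕ.+ (work c ℕ.+ work d)
-- The second guard pays for the failing test that leaves the loop.
work (while b loop c end)    = suc (timeᴮ b) ℕ.+ work c ℕ.+ suc (timeᴮ b)

-- A program logic for total correctness with time bounds

module Triples (𝓡 : RealNumbers) (α : RealNumbers.ℝ 𝓡) {n p : ℕ}
               (I : Dispersion.Instance 𝓡 α n p) (space word : ℕ) where

  open Dispersion 𝓡 α
  open Execution I
  open Run space word
  open import Data.Nat using (_+_)

  Halts : Program → State → ℕ → (State → Set) → Set
  Halts c σ T Q = ∃[ t ] ∃[ σ′ ] (c , σ ⇓[ t ] σ′) × t ≤ T × Q σ′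

  private variable
    b : BExp
    c d : Program
    σ : State
    M M′ : ℕ
    Q Q′ : State → Set

  -- Being a record, it lets inference recover `c` and `M`, which could not be read off the product
  -- `M * work c`.
  record Runs (c : Program) (σ : State) (M : ℕ) (Q : State → Set) : Set where
    constructor runs
    field halts : Halts c σ (M * work c) Q
  open Runs public

  weaken : (∀ {σ′} → Q σ′ → Q′ σ′) → Runs c σ M Q → Runs c σ M Q′
  weaken Q⇒Q′ (runs (t , σ′ , run , t≤ , q)) = runs (t , σ′ , run , t≤ , Q⇒Q′ q)

  moreTime : M ≤ M′ → Runs c σ M Q → Runs c σ M′ Q
  moreTime {c = c} M≤M′ (runs (t , σ′ , run , t≤ , q)) =
    runs (t , σ′ , run , ℕ.≤-trans t≤ (ℕ.*-monoˡ-≤ (work c) M≤M′) , q)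

  skip-runs : .{{_ : NonZero M}} → Runs skip σ M (σ ≡_)
  skip-runs {M} = runs (_ , _ , ⇓skip , ℕ.m≤n*m 1 M , refl)

  -- Assignments have an equation with the new state as postcondition, so that matching on `refl`
  -- executes a program symbolically.
  regᴵ-runs : ∀ {r e} → .{{_ : NonZero M}} → evalᴵ e σ ≤ word →
              Runs (r ≔ᴵ e) σ M (record σ { iregs = iregs σ [ r ↦ evalᴵ e σ ] } ≡_)
  regᴵ-runs {M} fits = runs (_ , _ , ⇓regᴵ fits , ℕ.m≤n*m _ M , refl)

  regᴿ-runs : ∀ {r e} → .{{_ : NonZero M}} →
              Runs (r ≔ᴿ e) σ M (record σ { rregs = rregs σ [ r ↦ evalᴿ e σ ] } ≡_)
  regᴿ-runs {M} = runs (_ , _ , ⇓regᴿ , ℕ.m≤n*m _ M , refl)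

  cellᴵ-runs : ∀ {a e} → .{{_ : NonZero M}} → evalᴵ a σ < space → evalᴵ e σ ≤ word →
               Runs (cellᴵ a ≔ e) σ M
                 (record σ { icells = icells σ [ evalᴵ a σ ↦ evalᴵ e σ ] } ≡_)
  cellᴵ-runs {M} a<space fits = runs (_ , _ , ⇓cellᴵ a<space fits , ℕ.m≤n*m _ M , refl)

  cellᴿ-runs : ∀ {a e} → .{{_ : NonZero M}} → evalᴵ a σ < space →
               Runs (cellᴿ a ≔ e) σ M
                 (record σ { rcells = rcells σ [ evalᴵ a σ ↦ evalᴿ e σ ] } ≡_)
  cellᴿ-runs {M} a<space = runs (_ , _ , ⇓cellᴿ a<space , ℕ.m≤n*m _ M , refl)

  infix 3 _ensuring_
  _ensuring_ : ∀ {σ′} → Runs c σ M (σ′ ≡_) → Q σ′ → Runs c σ M Q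
  runs (t , σ′ , run , t≤ , refl) ensuring q = runs (t , σ′ , run , t≤ , q)

  infixr 2 _⟫_
  _⟫_ : Runs c σ M Q →
        (∀ {σ′} → Q σ′ → Runs d σ′ M Q′) →
        Runs (c ⨾ d) σ M Q′
  _⟫_ {c = c} {M = M} {d = d} (runs (s , σ′ , run , s≤ , q)) k with k q
  ... | runs (t , σ″ , run′ , t≤ , q′) = runs
    (s + t , σ″ , ⇓seq run run′ ,
     subst (s + t ≤_) (sym (ℕ.*-distribˡ-+ M (work c) (work d))) (ℕ.+-mono-≤ s≤ t≤) , q′)

  private
    charge : ∀ g {t u v} → .{{_ : NonZero M}} → t ≤ M * u → u ≤ v → g + t ≤ M * (g + v)
    charge {M} g {t} {v = v} t≤ u≤v = subst (g + t ≤_) (sym (ℕ.*-distribˡ-+ M g v))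
      (ℕ.+-mono-≤ (ℕ.m≤n*m g M) (ℕ.≤-trans t≤ (ℕ.*-monoʳ-≤ M u≤v)))

  if-runs : .{{_ : NonZero M}} →
             (evalᴮ b σ ≡ true → Runs c σ M Q) →
             (evalᴮ b σ ≡ false → Runs d σ M Q) →
             Runs (if b then c else d fi) σ M Q
  if-runs {b = b} {σ = σ} {c = c} {d = d} then′ else′ with evalᴮ b σ in eq
  ... | true  = let t , σ′ , run , t≤ , q = halts (then′ refl) in runs
    (_ , σ′ , ⇓ifᵗ eq run , charge (suc (timeᴮ b)) t≤ (ℕ.m≤m+n (work c) (work d)) , q)
  ... | false = let t , σ′ , run , t≤ , q = halts (else′ refl) in runs
    (_ , σ′ , ⇓ifᶠ eq run , charge (suc (timeᴮ b)) t≤ (ℕ.m≤n+m (work d) (work c)) , q)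

  loopTime : BExp → Program → (iterations M : ℕ) → ℕ
  loopTime b c k M = k * (suc (timeᴮ b) + M * work c) + suc (timeᴮ b)

  -- Each iteration costs one guard and `M * work c`. As `N` and `M` are at least 1, the guards,
  -- which are not multiplied by `M`, are absorbed into `N * M` copies.
  loopTime-≤ : ∀ b c {k N M} .{{_ : NonZero N}} .{{_ : NonZero M}} → k ≤ N →
               loopTime b c k M ≤ N * M * work (while b loop c end)
  loopTime-≤ b c {k} {N} {M} k≤N = begin
    k * (g + M * w) + g                ≤⟨ ℕ.+-mono-≤ (ℕ.*-monoˡ-≤ (g + M * w) k≤N) (ℕ.m≤n*m g (N * M)) ⟩
    N * (g + M * w) + N * M * g        ≤⟨ ℕ.+-monoˡ-≤ _ (ℕ.*-monoʳ-≤ N (charge {M} g ℕ.≤-refl ℕ.≤-refl)) ⟩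
    N * (M * (g + w)) + N * M * g      ≡⟨ cong (_+ N * M * g) (sym (ℕ.*-assoc N M (g + w))) ⟩
    N * M * (g + w) + N * M * g        ≡⟨ sym (ℕ.*-distribˡ-+ (N * M) (g + w) g) ⟩
    N * M * (g + w + g)                ∎
    where
    open ℕ.≤-Reasoning
    g = suc (timeᴮ b)
    w = work c
    instance NM≢0 = ℕ.m*n≢0 N M

  -- The bound is expressed in the number `k` of iterations left, so it passes through an induction
  -- on `k`; rounding up to a multiple of `work` is left to `loop-runs`.
  record Loops (b : BExp) (c : Program) (σ : State) (k M : ℕ) (Q : State → Set) : Set where
    constructor loops
    field loop-halts : Halts (while b loop c end) σ (loopTime b c k M) Q

  loop-runs : ∀ {b c k N} .{{_ : NonZero N}} .{{_ : NonZero M}} → k ≤ N →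
              Loops b c σ k M Q → Runs (while b loop c end) σ (N * M) Q
  loop-runs {b = b} {c} k≤N (loops (t , σ′ , run , t≤ , q)) =
    runs (t , σ′ , run , ℕ.≤-trans t≤ (loopTime-≤ b c k≤N) , q)

  loop-exit : evalᴮ b σ ≡ false → Q σ → Loops b c σ 0 M Q
  loop-exit b≡false q = loops (_ , _ , ⇓whileᶠ b≡false , ℕ.≤-refl , q)

  weakenLoops : ∀ {k} → (∀ {σ′} → Q σ′ → Q′ σ′) → Loops b c σ k M Q → Loops b c σ k M Q′
  weakenLoops Q⇒Q′ (loops (t , σ′ , run , t≤ , q)) = loops (t , σ′ , run , t≤ , Q⇒Q′ q)

  loop-step : ∀ {b c M k} → evalᴮ b σ ≡ true → Runs c σ M Q →
              (∀ {σ′} → Q σ′ → Loops b c σ′ k M Q′) → Loops b c σ (suc k) M Q′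
  loop-step {b = b} {c} {M} b≡true (runs (s , σ′ , run , s≤ , q)) rest with rest q
  ... | loops (t , σ″ , run′ , t≤ , q′) = loops
    (_ , σ″ , ⇓whileᵗ b≡true run run′ ,
     ℕ.≤-trans (ℕ.+-mono-≤ (ℕ.+-monoʳ-≤ (suc (timeᴮ b)) s≤) t≤)
               (ℕ.≤-reflexive (sym (ℕ.+-assoc (suc (timeᴮ b) + M * work c) _ _))) , q′)

  loop-invariant : ∀ {b c M} N .{{_ : NonZero N}} .{{_ : NonZero M}} (Inv : ℕ → State → Set) →
                   (∀ σ {m} → m < N → Inv m σ → evalᴮ b σ ≡ true × Runs c σ M (Inv (suc m))) →
                   (∀ σ → Inv N σ → evalᴮ b σ ≡ false) →
                   Inv 0 σ → Runs (while b loop c end) σ (N * M) (Inv N)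
  loop-invariant {b = b} {c} {M} N Inv body exit inv₀ =
    loop-runs ℕ.≤-refl (go N (ℕ.+-identityʳ N) inv₀)
    where
    go : ∀ {m σ} k → k + m ≡ N → Inv m σ → Loops b c σ k M (Inv N)
    go zero    refl inv = loop-exit (exit _ inv) inv
    go {m = m} (suc k) eq inv =
      let b≡true , run = body _ (subst (m <_) eq (s≤s (ℕ.m≤n+m m k))) inv
      in loop-step b≡true run (go k (trans (ℕ.+-suc k m) eq))

-- Selections as paths, and optimality from the first point

module Paths (𝓡 : RealNumbers) (α : RealNumbers.ℝ 𝓡)
             (0<α : RealNumbers._<_ 𝓡 (RealNumbers.0# 𝓡) α)
             {n q : ℕ} (I : Dispersion.Instance 𝓡 α n (suc (suc q))) where

  open RealNumbers 𝓡 renaming (_*_ to _·_; _<_ to _<ʳ_; _≤_ to _≤ʳ_)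
  open OrderedField 𝓡
  open Distance 𝓡 α 0<α
  open Dispersion 𝓡 α
  open Instance I

  -- The input position of x a.
  pos : Fin n → ℕ
  pos a = toℕ (π ⟨$⟩ˡ a)

  pos<n : ∀ a → pos a < n
  pos<n a = Fin.toℕ<n (π ⟨$⟩ˡ a)

  point-at : ∀ {m} → m < n → ∃[ a ] m ≡ pos a
  point-at m<n = π ⟨$⟩ʳ fromℕ< m<n ,
    sym (trans (cong toℕ (inverseˡ π)) (Fin.toℕ-fromℕ< m<n))

  pos-injective : ∀ {a b} → pos a ≡ pos b → a ≡ b
  pos-injective eq = trans (sym (inverseʳ π))
    (trans (cong (π ⟨$⟩ʳ_) (Fin.toℕ-injective eq)) (inverseʳ π))

  -- Advances an invariant of a scan over input positions: `pos` is injective, so `b` is the only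
  -- index at the new position.
  one-more : ∀ {m b} {B : Fin n → Set} → m ≡ pos b →
             (∀ a → pos a < m → B a) → B b → ∀ a → pos a < suc m → B a
  one-more m≡b below at-b a a≤m with ℕ.m<1+n⇒m<n∨m≡n a≤m
  ... | inj₁ a<m = below a a<m
  ... | inj₂ a≡m with pos-injective (trans a≡m m≡b)
  ...   | refl = at-b

  input-pos : ∀ a → input (pos a) ≡ x a
  input-pos a with pos a ℕ.<? n
  ... | yes lt = cong x (trans (cong (π ⟨$⟩ʳ_) (Fin.fromℕ<-toℕ (π ⟨$⟩ˡ a) lt)) (inverseʳ π))
  ... | no ≮n  = contradiction (pos<n a) ≮n

  x-≺ : ∀ {a b} → a Fin.< b → x a ≺ x b
  x-≺ a<b with front (Fin.<⇒≢ a<b)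
  ... | inj₁ a≺b = a≺b
  ... | inj₂ b≺a = contradiction (proj₁ b≺a) (<ʳ-asym (sorted a<b))

  sorted⁻¹ : ∀ {a b} → proj₁ (x a) <ʳ proj₁ (x b) → a Fin.< b
  sorted⁻¹ {a} {b} lt with Fin.<-cmp a b
  ... | tri< a<b _ _  = a<b
  ... | tri≈ _ refl _ = contradiction lt (<ʳ-irrefl refl)
  ... | tri> _ _ b<a  = contradiction lt (<ʳ-asym (sorted b<a))

  δ : Fin n → Fin n → ℝ
  δ a b = distᵅ (x a) (x b)

  δ-nonneg : ∀ {a b} → a Fin.< b → 0# ≤ʳ δ a b
  δ-nonneg a<b = inj₁ (distᵅ-pos (x-≺ a<b))

  δ-monoˡ : ∀ {a b c} → a Fin.≤ b → b Fin.< c → δ b c ≤ʳ δ a c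
  δ-monoˡ {a} {b} a≤b b<c with Fin.<-cmp a b
  ... | tri< a<b _ _  = inj₁ (distᵅ-growˡ (x-≺ a<b) (x-≺ b<c))
  ... | tri≈ _ refl _ = ≤ʳ-refl
  ... | tri> _ _ b<a  = contradiction a≤b (ℕ.<⇒≱ b<a)

  δ-monoʳ : ∀ {a b c} → a Fin.< b → b Fin.≤ c → δ a b ≤ʳ δ a c
  δ-monoʳ {a} {b} {c} a<b b≤c with Fin.<-cmp b c
  ... | tri< b<c _ _  = inj₁ (distᵅ-growʳ (x-≺ a<b) (x-≺ b<c))
  ... | tri≈ _ refl _ = ≤ʳ-refl
  ... | tri> _ _ c<b  = contradiction b≤c (ℕ.<⇒≱ c<b)

  -- Path k a v: a selection of k + 1 points starting at x a, of value v.
  data Path : ℕ → Fin n → ℝ → Set where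
    end  : ∀ {a} → Path 0 a 0#
    step : ∀ {k a b v} → a Fin.< b → Path k b v → Path (suc k) a (δ a b + v)

  nodes : ∀ {k a v} → Path k a v → Fin (suc k) → Fin n
  nodes {a = a} _          Fin.zero    = a
  nodes         (step _ P) (Fin.suc i) = nodes P i

  nodes-increasing : ∀ {k a v} (P : Path k a v) → IsSelection (nodes P)
  nodes-increasing (step a<b P) {Fin.zero}  {Fin.suc Fin.zero}    _ = a<b
  nodes-increasing (step a<b P) {Fin.zero}  {Fin.suc (Fin.suc k)} _ =
    Fin.<-trans a<b (nodes-increasing P {Fin.zero} {Fin.suc k} (s≤s z≤n))
  nodes-increasing (step a<b P) {Fin.suc j} {Fin.suc k} (s≤s j<k) = nodes-increasing P j<k

  value-nodes : ∀ {k a v} (P : Path k a v) → value x (nodes P) ≡ v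
  value-nodes end                 = refl
  value-nodes (step {a = a} {b} _ P) = cong (δ a b +_) (value-nodes P)

  selection-path : ∀ {k} (i : Fin (suc k) → Fin n) → IsSelection i →
                   Path k (i Fin.zero) (value x i)
  selection-path {zero}  i sel = end
  selection-path {suc k} i sel =
    step (sel (s≤s z≤n)) (selection-path (λ j → i (Fin.suc j)) (λ j<k → sel (s≤s j<k)))

  uncons : ∀ {k a v} → Path (suc k) a v → ∃[ b ] a Fin.< b × ∃[ w ] Path k b w
  uncons (step a<b P) = _ , a<b , _ , P

  path-nonneg : ∀ {k a v} → Path k a v → 0# ≤ʳ v
  path-nonneg end          = ≤ʳ-refl
  path-nonneg (step a<b P) = +-nonneg (δ-nonneg a<b) (path-nonneg P)

  IsFirst : Fin n → Set
  IsFirst a = (b : Fin n) → a Fin.≤ b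

  -- Only the first distance changes, and on a Pareto front it grows.
  path-from-first : ∀ {k a b v} → IsFirst a → Path (suc k) b v →
                    ∃[ w ] Path (suc k) a w × v ≤ʳ w
  path-from-first {b = b} first (step {v = v} b<c P) =
    _ , step (ℕ.≤-<-trans (first b) b<c) P , +-monoˡ-≤ʳ v (δ-monoˡ (first b) b<c)

  -- As `p ≤ n`, the first `p` indices form a selection. This guarantees that the searches from the
  -- first point find something.
  first-path : ∀ {a} → IsFirst a → ∃[ v ] Path (suc q) a v
  first-path first =
    let v , P , _ = path-from-first first (selection-path (λ j → inject≤ j p≤n) inject-sel) in v , P
    where
    inject-sel : IsSelection {n} {suc (suc q)} (λ j → inject≤ j p≤n)
    inject-sel {j} {k} j<k = subst₂ _<_ (sym (Fin.toℕ-inject≤ j p≤n)) (sym (Fin.toℕ-inject≤ k p≤n)) j<k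

  UpperBound : ℕ → Fin n → ℝ → Set
  UpperBound k a v = ∀ {u} → Path k a u → u ≤ʳ v

  -1# : ℝ
  -1# = 0# - 1#

  -- -1# encodes that there is no path, values of paths being nonnegative.
  IsBest : ℕ → Fin n → ℝ → Set
  IsBest k a v = UpperBound k a v × (v ≡ -1# ⊎ Path k a v)

  best-path : ∀ {k a u v} → IsBest k a v → Path k a u → Path k a v
  best-path (upper , inj₂ P) _ = P
  best-path (upper , inj₁ refl) P =
    contradiction -1<0 (≤⇒≯ʳ (≤ʳ-trans (path-nonneg P) (upper P)))

  -- Together with `feasible-path`, this makes the test `-1 < v` of the program equivalent to the
  -- existence of a path.
  best-feasible : ∀ {k a u v} → IsBest k a v → Path k a u → -1# <ʳ v
  best-feasible best P = <-≤-transʳ -1<0 (path-nonneg (best-path best P))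

  feasible-path : ∀ {k a v} → IsBest k a v → -1# <ʳ v → Path k a v
  feasible-path (_ , inj₁ v≡-1) lt = contradiction lt (<ʳ-irrefl (sym v≡-1))
  feasible-path (_ , inj₂ P)    lt = P

  path-answer : ∀ σ {a v} → IsFirst a → (P : Path (suc q) a v) → UpperBound (suc q) a v →
                rregs σ 0 ≡ v → (∀ i → icells σ (toℕ i) ≡ pos (nodes P i)) →
                Execution.IsAnswer I σ
  path-answer σ {v = v} first P upper out≡v cells =
    nodes P , (nodes-increasing P , optimal) , trans out≡v (sym (value-nodes P)) , cells
    where
    optimal : ∀ i → IsSelection i → value x i ≤ʳ value x (nodes P)
    optimal i sel =
      -- `upper` covers only paths from `a`; an arbitrary selection is first moved to start there,
      -- without loss.
      let w , P′ , ≤w = path-from-first first (selection-path i sel)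
      in subst (value x i ≤ʳ_) (sym (value-nodes P)) (≤ʳ-trans ≤w (upper P′))

-- Correctness of the linear scans

module Searches (𝓡 : RealNumbers) (α : RealNumbers.ℝ 𝓡)
                (0<α : RealNumbers._<_ 𝓡 (RealNumbers.0# 𝓡) α)
                {n q : ℕ} (I : Dispersion.Instance 𝓡 α n (suc (suc q)))
                (space word : ℕ) (n≤word : n ≤ word) where

  open RealNumbers 𝓡 renaming (_*_ to _·_; _<_ to _<ʳ_; _≤_ to _≤ʳ_)
  open OrderedField 𝓡
  open Dispersion 𝓡 α
  open Instance I
  open Execution I
  open Triples 𝓡 α I space word
  open Paths 𝓡 α 0<α I

  instance
    n≢0 : NonZero n
    n≢0 = ℕ.>-nonZero (ℕ.≤-trans (s≤s z≤n) p≤n)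

  increment-fits : ∀ {m i} → i ≡ m → m < n → i ℕ.+ 1 ≤ word
  increment-fits {m} refl m<n = ℕ.≤-trans (ℕ.≤-reflexive (ℕ.+-comm m 1)) (ℕ.≤-trans m<n n≤word)

  -- The integer registers below k and the real register best are scratch.
  Frame : ℕ → State → State → Set
  Frame k σ σ′ = (∀ r → iregs σ′ (k ℕ.+ r) ≡ iregs σ (k ℕ.+ r)) ×
                 rregs σ′ out ≡ rregs σ out ×
                 icells σ′ ≡ icells σ ×
                 rcells σ′ ≡ rcells σ

  Candidate : (Fin n → Bool) → Fin n → Fin n → Set
  Candidate test a b = a Fin.< b × test b ≡ true

  -- The value `-1#` is not claimed to mean that there is no candidate; that conclusion needs
  -- nonnegative tails and is drawn in `found-candidate`.
  Found : Fin n → (Fin n → Bool) → (Fin n → ℝ) → ℕ → State → Set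
  Found a test w m σ =
    (∀ b → pos b < m → Candidate test a b → δ a b + w b ≤ʳ rregs σ best) ×
    (rregs σ best ≡ -1# ⊎
     ∃[ b ] Candidate test a b × iregs σ arg ≡ pos b × rregs σ best ≡ δ a b + w b)

  -- `F` and `T` may depend on the candidate and on what the frame preserves. One proof thus covers
  -- the farthest point, the middle point and the table rows.
  search-runs :
    ∀ {σ a F T} (test : Fin n → Bool) (w : Fin n → ℝ) → iregs σ src ≡ pos a →
    (∀ σ′ {b} → Frame 2 σ σ′ → iregs σ′ cand ≡ pos b →
       evalᴮ F σ′ ≡ test b × evalᴿ T σ′ ≡ w b) →
    Runs (search F T) σ (n * 1)
      (λ σ′ → Frame 2 σ σ′ × Found a test w n σ′)
  search-runs {σ₀} {a} {F} {T} test w src≡a eval-FT =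
    regᴿ-runs ⟫ λ { refl →
    regᴵ-runs z≤n ⟫ λ { refl →
    weaken proj₂ (loop-invariant n Inv body exit (refl , ((λ _ → refl) , refl , refl , refl) , (λ _ ()) , inj₁ refl)) } }
    where
    instance n*1≢0 = ℕ.m*n≢0 n 1

    Inv : ℕ → State → Set
    Inv m σ = iregs σ cand ≡ m × Frame 2 σ₀ σ × Found a test w m σ

    exit : ∀ σ → Inv n σ → evalᴮ (regᴵ cand <ᴵ inputN) σ ≡ false
    exit σ (cand≡n , _) = ⌊⌋-false (_ ℕ.<? n) (ℕ.<-irrefl cand≡n)

    improve-runs : ∀ σ → iregs σ cand < n → Frame 2 σ₀ σ → Found a test w (iregs σ cand) σ →
      Runs (improve F T) σ 1
        (λ σ′ → iregs σ′ cand ≡ iregs σ cand × Frame 2 σ₀ σ′ × Found a test w (suc (iregs σ cand)) σ′)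
    improve-runs σ m<n frame@(same , _) (upper , attained) =
      if-runs
        (λ lt → if-runs
          (λ feasible → if-runs
            (λ better → regᴿ-runs ⟫ λ { refl → regᴵ-runs (ℕ.≤-trans (ℕ.<⇒≤ m<n) n≤word) ensuring
              (refl , frame ,
               one-more cand≡b
                 (λ b′ b′<m cb′ → ≤ʳ-trans (upper b′ b′<m cb′) (inj₁ (⌊⌋-true⁻¹ (_ <? _) better)))
                 (λ _ → inj₂ (sym value≡)) ,
               inj₂ (b , (sorted⁻¹ (subst₂ _<ʳ_ (cong proj₁ src≡) (cong proj₁ cand≡) (⌊⌋-true⁻¹ (_ <? _) lt)) ,
                          trans (sym test≡) feasible) , cand≡b , value≡)) })
            (λ worse → skip-runs ensuring
              keep (λ _ → subst (_≤ʳ _) value≡ (≮⇒≥ʳ (⌊⌋-false⁻¹ (_ <? _) worse)))))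
          (λ infeasible → skip-runs ensuring
            keep (λ { (_ , tb) → contradiction (trans (sym tb) (trans (sym test≡) infeasible)) λ () })))
        (λ ge → skip-runs ensuring
          keep (λ { (a<b , _) → contradiction
            (subst₂ _<ʳ_ (sym (cong proj₁ src≡)) (sym (cong proj₁ cand≡)) (sorted a<b))
            (⌊⌋-false⁻¹ (_ <? _) ge) }))
      where
      b = proj₁ (point-at m<n)
      cand≡b = proj₂ (point-at m<n)
      src≡ : input (iregs σ src) ≡ x a
      src≡ = trans (cong input (trans (same 0) src≡a)) (input-pos a)
      cand≡ : input (iregs σ cand) ≡ x b
      cand≡ = trans (cong input cand≡b) (input-pos b)
      test≡ = proj₁ (eval-FT σ frame cand≡b)
      value≡ : evalᴿ (dissim (regᴵ src) (regᴵ cand) +ᴿ T) σ ≡ δ a b + w b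
      value≡ = cong₂ _+_ (cong₂ distᵅ src≡ cand≡) (proj₂ (eval-FT σ frame cand≡b))
      keep : (Candidate test a b → δ a b + w b ≤ʳ rregs σ best) →
             iregs σ cand ≡ iregs σ cand × Frame 2 σ₀ σ × Found a test w (suc (iregs σ cand)) σ
      keep at-b = refl , frame , one-more cand≡b upper at-b , attained

    body : ∀ σ {m} → m < n → Inv m σ →
           evalᴮ (regᴵ cand <ᴵ inputN) σ ≡ true ×
           Runs (improve F T ⨾ cand ≔ᴵ regᴵ cand +ᴵ litᴵ 1) σ 1 (Inv (suc m))
    body σ m<n (refl , frame , found) = ⌊⌋-true (_ ℕ.<? n) m<n , (
      improve-runs σ m<n frame found ⟫ λ { {σ′} (cand≡m , frame , found) →
      regᴵ-runs (increment-fits cand≡m m<n) ensuring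
        (trans (ℕ.+-comm _ 1) (cong suc cand≡m) , frame , found) })

  found-candidate : ∀ σ {a b test w} → Found a test w n σ → Candidate test a b → 0# ≤ʳ w b →
    ∃[ b′ ] Candidate test a b′ × iregs σ arg ≡ pos b′ × rregs σ best ≡ δ a b′ + w b′
  found-candidate σ (upper , inj₂ attained) _ _ = attained
  found-candidate σ {b = b} (upper , inj₁ ≡-1) cb@(a<b , _) 0≤w =
    contradiction -1<0 (≤⇒≯ʳ (subst (0# ≤ʳ_) ≡-1
      (≤ʳ-trans (+-nonneg (δ-nonneg a<b) 0≤w) (upper b (pos<n b) cb))))

  FirstIn : ℕ → State → Set
  FirstIn m σ = ∃[ a ] iregs σ src ≡ pos a × (∀ b → pos b < m → a Fin.≤ b)

  findMin-runs : ∀ {σ} → Runs findMin σ (n * 1)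
    (λ σ′ → Frame 3 σ σ′ × ∃[ a ] iregs σ′ src ≡ pos a × IsFirst a)
  findMin-runs {σ₀} =
    regᴵ-runs z≤n ⟫ λ { refl →
    regᴵ-runs z≤n ⟫ λ { refl →
    weaken (λ { (_ , frame , a , src≡a , first) → frame , a , src≡a , λ b → first b (pos<n b) })
      (loop-invariant n Inv body exit
        (refl , ((λ _ → refl) , refl , refl , refl) ,
         -- The point at position 0 may be held before it is scanned, because no position is below
         -- 0.
         proj₁ point₀ , proj₂ point₀ , λ _ ())) } }
    where
    instance n*1≢0 = ℕ.m*n≢0 n 1

    point₀ = point-at (ℕ.n≢0⇒n>0 (ℕ.≢-nonZero⁻¹ n))

    Inv : ℕ → State → Set
    Inv m σ = iregs σ cand ≡ m × Frame 3 σ₀ σ × FirstIn m σ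

    exit : ∀ σ → Inv n σ → evalᴮ (regᴵ cand <ᴵ inputN) σ ≡ false
    exit σ (cand≡n , _) = ⌊⌋-false (_ ℕ.<? n) (ℕ.<-irrefl cand≡n)

    replaceMin-runs : ∀ σ → iregs σ cand < n → Frame 3 σ₀ σ → FirstIn (iregs σ cand) σ →
      Runs replaceMin σ 1
        (λ σ′ → iregs σ′ cand ≡ iregs σ cand × Frame 3 σ₀ σ′ × FirstIn (suc (iregs σ cand)) σ′)
    replaceMin-runs σ m<n frame (a , src≡a , first) =
      if-runs
        (λ lt → let b<a = sorted⁻¹ (subst₂ _<ʳ_ (cong proj₁ cand≡) (cong proj₁ src≡) (⌊⌋-true⁻¹ (_ <? _) lt)) in
          regᴵ-runs (ℕ.≤-trans (ℕ.<⇒≤ m<n) n≤word) ensuring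
            (refl , frame , b , cand≡b ,
             one-more {B = λ b′ → b Fin.≤ b′} cand≡b (λ b′ b′<m → ℕ.≤-trans (ℕ.<⇒≤ b<a) (first b′ b′<m)) ℕ.≤-refl))
        (λ ge → skip-runs ensuring
          (refl , frame , a , src≡a ,
           one-more {B = λ b′ → a Fin.≤ b′} cand≡b first (ℕ.≮⇒≥ (λ b<a → contradiction
             (subst₂ _<ʳ_ (sym (cong proj₁ cand≡)) (sym (cong proj₁ src≡)) (sorted b<a))
             (⌊⌋-false⁻¹ (_ <? _) ge)))))
      where
      b = proj₁ (point-at m<n)
      cand≡b = proj₂ (point-at m<n)
      src≡ : input (iregs σ src) ≡ x a
      src≡ = trans (cong input src≡a) (input-pos a)
      cand≡ : input (iregs σ cand) ≡ x b
      cand≡ = trans (cong input cand≡b) (input-pos b)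

    body : ∀ σ {m} → m < n → Inv m σ →
           evalᴮ (regᴵ cand <ᴵ inputN) σ ≡ true ×
           Runs (replaceMin ⨾ cand ≔ᴵ regᴵ cand +ᴵ litᴵ 1) σ 1 (Inv (suc m))
    body σ m<n (refl , frame , first) = ⌊⌋-true (_ ℕ.<? n) m<n , (
      replaceMin-runs σ m<n frame first ⟫ λ { {σ′} (cand≡m , frame , first) →
      regᴵ-runs (increment-fits cand≡m m<n) ensuring
        (trans (ℕ.+-comm _ 1) (cong suc cand≡m) , frame , first) })

-- Two and three points

module FewPoints (𝓡 : RealNumbers) (α : RealNumbers.ℝ 𝓡)
                 (0<α : RealNumbers._<_ 𝓡 (RealNumbers.0# 𝓡) α)
                 {n : ℕ} (space word : ℕ) (2<space : 2 < space) (n≤word : n ≤ word) where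

  open RealNumbers 𝓡 renaming (_*_ to _·_; _<_ to _<ʳ_; _≤_ to _≤ʳ_)
  open OrderedField 𝓡
  open Distance 𝓡 α 0<α
  open Dispersion 𝓡 α

  private
    pos≤word : ∀ {m} → m < n → m ≤ word
    pos≤word m<n = ℕ.≤-trans (ℕ.<⇒≤ m<n) n≤word

    1<space : 1 < space
    1<space = ℕ.<-trans (s≤s (s≤s z≤n)) 2<space

    0<space : 0 < space
    0<space = ℕ.<-trans (s≤s z≤n) 1<space

  twoPoints-runs : ∀ (I : Instance n 2) {σ} →
    Triples.Runs 𝓡 α I space word twoPoints σ (n * 1) (Execution.IsAnswer I)
  twoPoints-runs I =
    findMin-runs ⟫ λ { (_ , a , src≡a , first) →
    search-runs (λ _ → true) (λ _ → 0#) src≡a (λ _ _ _ → refl , refl) ⟫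
    λ { {σ} ((same , _) , found@(upper , _)) →
    let _ , a<c , _ = uncons (proj₂ (first-path first))
        b , (a<b , _) , arg≡b , best≡ = found-candidate σ found (a<c , refl) ≤ʳ-refl
        src≡a = trans (same 0) src≡a
    in
    regᴿ-runs ⟫ λ { refl →
    cellᴵ-runs 0<space (subst (_≤ word) (sym src≡a) (pos≤word (pos<n a))) ⟫ λ { refl →
    weaken (λ { {τ} refl → path-answer τ first (step a<b end)
        (λ { (step {b = c} a<c end) → subst (δ a c + 0# ≤ʳ_) best≡ (upper c (pos<n c) (a<c , refl)) })
        best≡
        (λ { Fin.zero → src≡a ; (Fin.suc Fin.zero) → arg≡b }) })
      (cellᴵ-runs 1<space (subst (_≤ word) (sym arg≡b) (pos≤word (pos<n b)))) } } } }
    where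
    open Triples 𝓡 α I space word
    open Paths 𝓡 α 0<α I
    open Searches 𝓡 α 0<α I space word n≤word
    instance n*1≢0 = ℕ.m*n≢0 n 1

  threePoints-runs : ∀ (I : Instance n 3) {σ} →
    Triples.Runs 𝓡 α I space word threePoints σ (n * 1) (Execution.IsAnswer I)
  threePoints-runs I =
    findMin-runs ⟫ λ { (_ , a , src≡a , first) →
    search-runs (λ _ → true) (λ _ → 0#) src≡a (λ _ _ _ → refl , refl) ⟫
    λ { {σ} ((same , _) , found@(upper , _)) →
    -- A path of three points from `a` provides `e < f`. As `c` is last, `e < f ≤ c`, so `e` is a
    -- feasible middle point for the second search.
    let e , a<e , _ , P = uncons (proj₂ (first-path first))
        f , e<f , _ = uncons P
        c , (a<c , _) , arg≡c , best≡ = found-candidate σ found (a<e , refl) ≤ʳ-refl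
        c-last = farthest-last σ a<c found best≡
        e<c = ℕ.<-≤-trans e<f (c-last f (ℕ.<-trans a<e e<f))
        src≡a = trans (same 0) src≡a
        test = λ b → ⌊ proj₁ (x b) <? proj₁ (x c) ⌋
        w = λ b → δ b c + 0#
        feasible = λ b → ⌊⌋-true (proj₁ (x b) <? proj₁ (x c))
    in
    regᴵ-runs (subst (_≤ word) (sym arg≡c) (pos≤word (pos<n c))) ⟫ λ { refl →
    search-runs test w src≡a
      (λ { σ′ {b} (same , _) cand≡b →
        let cand≡ = trans (cong input cand≡b) (input-pos b)
            base≡ = trans (cong input (trans (same 1) arg≡c)) (input-pos c)
        in cong₂ (λ y z → ⌊ proj₁ y <? proj₁ z ⌋) cand≡ base≡ ,
           cong₂ (λ y z → distᵅ y z + 0#) cand≡ base≡ }) ⟫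
    λ { {σ} ((same , _) , found@(upper , _)) →
    let b , (a<b , b-feasible) , arg≡b , best≡ =
          found-candidate σ found (a<e , feasible e (sorted e<c))
            (+-nonneg (δ-nonneg e<c) ≤ʳ-refl)
        b<c = sorted⁻¹ (⌊⌋-true⁻¹ (_ <? _) b-feasible)
        src≡a = trans (same 0) src≡a
        base≡c = trans (same 1) arg≡c
    in
    regᴿ-runs ⟫ λ { refl →
    cellᴵ-runs 0<space (subst (_≤ word) (sym src≡a) (pos≤word (pos<n a))) ⟫ λ { refl →
    cellᴵ-runs 1<space (subst (_≤ word) (sym arg≡b) (pos≤word (pos<n b))) ⟫ λ { refl →
    weaken (λ { {τ} refl → path-answer τ first (step a<b (step b<c end))
        -- Moving the end `j` of a competing path to `c` does not lower its value, and then its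
        -- middle point `i` is a candidate of the second search.
        (λ { (step {b = i} a<i (step {b = j} i<j end)) →
          let j≤c = c-last j (ℕ.<-trans a<i i<j) in
          ≤ʳ-trans (+-monoʳ-≤ʳ (δ a i) (+-monoˡ-≤ʳ 0# (δ-monoʳ i<j j≤c)))
            (subst (δ a i + w i ≤ʳ_) best≡
              (upper i (pos<n i) (a<i , feasible i (sorted (ℕ.<-≤-trans i<j j≤c))))) })
        best≡
        (λ { Fin.zero → src≡a
           ; (Fin.suc Fin.zero) → arg≡b
           ; (Fin.suc (Fin.suc Fin.zero)) → base≡c }) })
      (cellᴵ-runs 2<space (subst (_≤ word) (sym base≡c) (pos≤word (pos<n c)))) } } } } } } }
    where
    open Instance I
    open Triples 𝓡 α I space word
    open Paths 𝓡 α 0<α I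
    open Searches 𝓡 α 0<α I space word n≤word
    instance n*1≢0 = ℕ.m*n≢0 n 1

    -- A point after `c` would be strictly farther from `a` than the maximum found.
    farthest-last : ∀ σ {a c : Fin n} → a Fin.< c → Found a (λ _ → true) (λ _ → 0#) n σ →
                    rregs σ best ≡ δ a c + 0# → ∀ (e : Fin n) → a Fin.< e → e Fin.≤ c
    farthest-last σ {a} {c} a<c (upper , _) best≡ e a<e = ℕ.≮⇒≥ λ c<e →
      ≤⇒≯ʳ (subst (δ a e + 0# ≤ʳ_) best≡ (upper e (pos<n e) (a<e , refl)))
           (+-monoˡ-< 0# (distᵅ-growʳ (x-≺ a<c) (x-≺ c<e)))

-- The dynamic program: table, trace and optimality

module Dynamic (𝓡 : RealNumbers) (α : RealNumbers.ℝ 𝓡)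
               (0<α : RealNumbers._<_ 𝓡 (RealNumbers.0# 𝓡) α)
               {n q : ℕ} (I : Dispersion.Instance 𝓡 α n (suc (suc q)))
               (space word : ℕ)
               (pn≤space : suc (suc q) * n ≤ space) (pn≤word : suc (suc q) * n ≤ word) where

  open RealNumbers 𝓡 renaming (_*_ to _·_; _<_ to _<ʳ_; _≤_ to _≤ʳ_)
  open OrderedField 𝓡
  open Dispersion 𝓡 α
  open Instance I
  open Execution I
  open Triples 𝓡 α I space word
  open Paths 𝓡 α 0<α I

  private
    p : ℕ
    p = suc (suc q)

    n≤word : n ≤ word
    n≤word = ℕ.≤-trans (ℕ.m≤m+n n _) pn≤word

  open Searches 𝓡 α 0<α I space word n≤word

  private instance
    n*1≢0 : NonZero (n * 1)
    n*1≢0 = ℕ.m*n≢0 n 1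

    n^2≢0 : NonZero (n ^ 2)
    n^2≢0 = ℕ.m*n≢0 n (n * 1)

    pn^2≢0 : NonZero (p * n ^ 2)
    pn^2≢0 = ℕ.m*n≢0 p (n ^ 2)

  private
    p≤pn : p ≤ p * n
    p≤pn = ℕ.m≤m*n p n

    n*1≤pn^2 : n * 1 ≤ p * n ^ 2
    n*1≤pn^2 = ℕ.≤-trans (ℕ.m≤n*m (n * 1) n) (ℕ.m≤n*m (n ^ 2) p)

    -- Used both to keep addresses inside the heap and to separate finished rows from the row being
    -- written.
    row-end : ∀ {k l i} → l < k → i < n → l * n ℕ.+ i < k * n
    row-end {k} {l} {i} l<k i<n = ℕ.<-≤-trans (ℕ.+-monoʳ-< (l * n) i<n)
      (ℕ.≤-trans (ℕ.≤-reflexive (ℕ.+-comm (l * n) n)) (ℕ.*-monoˡ-≤ n l<k))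

    row≤word : ∀ {k} → k ≤ p → k * n ≤ word
    row≤word k≤p = ℕ.≤-trans (ℕ.*-monoˡ-≤ n k≤p) pn≤word

    layer≤word : ∀ {k} → k ≤ p → k ≤ word
    layer≤word k≤p = ℕ.≤-trans k≤p (ℕ.≤-trans p≤pn pn≤word)

    address<space : ∀ {k i} → k < p → i < n → k * n ℕ.+ i < space
    address<space k<p i<n = ℕ.<-≤-trans (row-end k<p i<n) pn≤space

  Row : ℕ → (ℕ → ℝ) → Set
  Row k V = ∀ a → IsBest k a (V (k * n ℕ.+ pos a))

  Rows : ℕ → (ℕ → ℝ) → Set
  Rows k V = ∀ {l} → l < k → Row l V

  Feasible : ℕ → (ℕ → ℝ) → Fin n → Bool
  Feasible k V b = ⌊ -1# <? V (k * n ℕ.+ pos b) ⌋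

  Tail : ℕ → (ℕ → ℝ) → Fin n → ℝ
  Tail k V b = V (k * n ℕ.+ pos b)

  searchRow-runs : ∀ {σ k a} → iregs σ base ≡ k * n → iregs σ src ≡ pos a →
    Runs searchRow σ (n * 1)
      (λ σ′ → Frame 2 σ σ′ × Found a (Feasible k (rcells σ)) (Tail k (rcells σ)) n σ′)
  searchRow-runs {σ} {k} base≡ src≡a =
    search-runs (Feasible k (rcells σ)) (Tail k (rcells σ)) src≡a
      λ { σ′ (same , _ , _ , V≡) cand≡b →
          let read≡ = trans (cong (λ V → V (iregs σ′ base ℕ.+ iregs σ′ cand)) V≡)
                        (cong₂ (λ i j → rcells σ (i ℕ.+ j)) (trans (same 1) base≡) cand≡b)
          in cong (λ v → ⌊ -1# <? v ⌋) read≡ , read≡ }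

  -- The recurrence. A path from `a` steps to some `b`, whose entry bounds the rest and is above
  -- `-1#`; conversely, an entry above `-1#` is the value of a path that the step from `a` extends.
  found-best : ∀ σ k V {a} → Row k V → Found a (Feasible k V) (Tail k V) n σ →
               IsBest (suc k) a (rregs σ best)
  found-best σ k V {a} row (upper , attained) = bound , reached attained
    where
    bound : UpperBound (suc k) a (rregs σ best)
    bound (step {b = b} a<b P) = ≤ʳ-trans (+-monoʳ-≤ʳ (δ a b) (proj₁ (row b) P))
      (upper b (pos<n b) (a<b , ⌊⌋-true (_ <? _) (best-feasible (row b) P)))

    reached : _ → rregs σ best ≡ -1# ⊎ Path (suc k) a (rregs σ best)
    reached (inj₁ ≡-1) = inj₁ ≡-1
    reached (inj₂ (b , (a<b , feasible) , _ , best≡)) = inj₂ (subst (Path (suc k) a) (sym best≡)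
      (step a<b (feasible-path (row b) (⌊⌋-true⁻¹ (_ <? _) feasible))))

  RowUpTo : ℕ → ℕ → (ℕ → ℝ) → Set
  RowUpTo k j V = ∀ a → pos a < j → IsBest k a (V (k * n ℕ.+ pos a))

  [↦]-new : ∀ {A : Set} (f : ℕ → A) {k l} v → l ≡ k → (f [ k ↦ v ]) l ≡ v
  [↦]-new f {k} {l} v l≡k with l ℕ.≡ᵇ k in eq
  ... | true  = refl
  ... | false = contradiction (subst T eq (ℕ.≡⇒≡ᵇ l k l≡k)) λ ()

  [↦]-old : ∀ {A : Set} (f : ℕ → A) {k l} v → ¬ l ≡ k → (f [ k ↦ v ]) l ≡ f l
  [↦]-old f {k} {l} v l≢k with l ℕ.≡ᵇ k in eq
  ... | true  = contradiction (ℕ.≡ᵇ⇒≡ l k (subst T (sym eq) tt)) l≢k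
  ... | false = refl

  row-extend : ∀ k V a {c v} → RowUpTo k (pos a) V → IsBest k a v → c ≡ k * n ℕ.+ pos a →
               RowUpTo k (suc (pos a)) (V [ c ↦ v ])
  row-extend k V a {c} {v} row best-a c≡ = one-more refl
    (λ b b<a → subst (IsBest k b)
      (sym ([↦]-old V v λ eq → ℕ.<⇒≢ b<a (ℕ.+-cancelˡ-≡ (k * n) _ _ (trans eq c≡)))) (row b b<a))
    (subst (IsBest k a) (sym ([↦]-new V v (sym c≡))) best-a)

  rows-keep : ∀ k V {j c v} → Rows k V → c ≡ k * n ℕ.+ j → Rows k (V [ c ↦ v ])
  rows-keep k V {j} {c} {v} rows c≡ {l} l<k a = subst (IsBest l a)
    (sym ([↦]-old V v λ eq → ℕ.<⇒≢ (ℕ.<-≤-trans (row-end l<k (pos<n a)) (ℕ.m≤m+n (k * n) j)) (trans eq c≡)))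
    (rows l<k a)

  firstRow-runs : ∀ {σ} → Runs firstRow σ (n * 1) (λ σ′ → Rows 1 (rcells σ′))
  firstRow-runs =
    regᴵ-runs z≤n ⟫ λ { refl →
    weaken (λ { (_ , row) {zero} _ a → row a (pos<n a) ; _ {suc _} (s≤s ()) })
      (loop-invariant n (λ j σ → iregs σ src ≡ j × RowUpTo 0 j (rcells σ)) body
        (λ { _ (src≡n , _) → ⌊⌋-false (_ ℕ.<? n) (ℕ.<-irrefl src≡n) })
        (refl , λ _ ())) }
    where
    body : ∀ σ {j} → j < n → iregs σ src ≡ j × RowUpTo 0 j (rcells σ) →
           evalᴮ (regᴵ src <ᴵ inputN) σ ≡ true ×
           Runs (cellᴿ regᴵ src ≔ 0ᴿ ⨾ src ≔ᴵ regᴵ src +ᴵ litᴵ 1) σ 1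
             (λ σ′ → iregs σ′ src ≡ suc j × RowUpTo 0 (suc j) (rcells σ′))
    body σ j<n (src≡j , row) with point-at j<n
    ... | a , refl = ⌊⌋-true (_ ℕ.<? n) (subst (_< n) (sym src≡j) j<n) , (
      cellᴿ-runs (subst (_< space) (sym src≡j) (address<space (s≤s z≤n) j<n)) ⟫ λ { refl →
      regᴵ-runs (increment-fits src≡j j<n) ensuring
        (trans (ℕ.+-comm _ 1) (cong suc src≡j) ,
         row-extend 0 (rcells σ) a row ((λ { end → ≤ʳ-refl }) , inj₂ end) src≡j) })

  -- The `n` searches have multiplier `n * 1` each, and `n ^ 2` unfolds to `n * (n * 1)`.
  nextRow-runs : ∀ {σ k} → suc k < p → iregs σ base ≡ k * n → Rows (suc k) (rcells σ) →
    Runs nextRow σ (n ^ 2) (λ σ′ → iregs σ′ base ≡ k * n × iregs σ′ layer ≡ iregs σ layer ×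
                                   Rows (suc (suc k)) (rcells σ′))
  nextRow-runs {σ₀} {k} 1+k<p base≡ rows =
    regᴵ-runs z≤n ⟫ λ { refl →
    weaken (λ { {σ} (_ , base≡ , layer≡ , rows , row) → base≡ , layer≡ , complete (rcells σ) rows row })
      (loop-invariant n Inv body
        (λ { _ (src≡n , _) → ⌊⌋-false (_ ℕ.<? n) (ℕ.<-irrefl src≡n) })
        (refl , base≡ , refl , rows , λ _ ())) }
    where
    Inv : ℕ → State → Set
    Inv j σ = iregs σ src ≡ j × iregs σ base ≡ k * n × iregs σ layer ≡ iregs σ₀ layer ×
              Rows (suc k) (rcells σ) × RowUpTo (suc k) j (rcells σ)

    complete : ∀ V → Rows (suc k) V → RowUpTo (suc k) n V → Rows (suc (suc k)) V
    complete V rows row l<2+k a with ℕ.m<1+n⇒m<n∨m≡n l<2+k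
    ... | inj₁ l<1+k = rows l<1+k a
    ... | inj₂ refl  = row a (pos<n a)

    body : ∀ σ {j} → j < n → Inv j σ →
           evalᴮ (regᴵ src <ᴵ inputN) σ ≡ true ×
           Runs (searchRow ⨾ cellᴿ inputN +ᴵ regᴵ base +ᴵ regᴵ src ≔ regᴿ best ⨾
                 src ≔ᴵ regᴵ src +ᴵ litᴵ 1) σ (n * 1) (Inv (suc j))
    body σ j<n (src≡j , base≡ , layer≡ , rows , row) with point-at j<n
    ... | a , refl = ⌊⌋-true (_ ℕ.<? n) (subst (_< n) (sym src≡j) j<n) , (
      searchRow-runs {k = k} base≡ src≡j ⟫ λ { {σ′} ((same , _ , _ , V≡) , found) →
      let src≡j   = trans (same 0) src≡j
          base≡   = trans (same 1) base≡
          address : n ℕ.+ iregs σ′ base ℕ.+ iregs σ′ src ≡ suc k * n ℕ.+ pos a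
          address = cong₂ (λ i j → n ℕ.+ i ℕ.+ j) base≡ src≡j
      in
      cellᴿ-runs (subst (_< space) (sym address) (address<space 1+k<p j<n)) ⟫ λ { refl →
      regᴵ-runs (increment-fits src≡j j<n) ensuring
        (trans (ℕ.+-comm _ 1) (cong suc src≡j) , base≡ , trans (same 2) layer≡ ,
         rows-keep (suc k) (rcells σ′) (subst (Rows (suc k)) (sym V≡) rows) address ,
         row-extend (suc k) (rcells σ′) a (subst (RowUpTo (suc k) (pos a)) (sym V≡) row)
           (found-best σ′ k (rcells σ) (rows ℕ.≤-refl) found) address) } })

  fillTable-runs : ∀ {σ} → Runs fillTable σ (p * n ^ 2)
    (λ σ′ → iregs σ′ base ≡ suc q * n × Rows p (rcells σ′))
  fillTable-runs =
    moreTime n*1≤pn^2 firstRow-runs ⟫ λ row₀ →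
    regᴵ-runs z≤n ⟫ λ { refl →
    regᴵ-runs (layer≤word (s≤s z≤n)) ⟫ λ { refl →
    -- Row 0 is already filled, so the loop makes `suc q`, that is `p - 1`, iterations.
    moreTime (ℕ.m≤n+m (suc q * n ^ 2) (n ^ 2)) (
    weaken (λ { (_ , base≡ , rows) → base≡ , rows })
      (loop-invariant (suc q) Inv body
        (λ { _ (layer≡p , _) → ⌊⌋-false (_ ℕ.<? p) (ℕ.<-irrefl layer≡p) })
        (refl , refl , row₀))) } }
    where
    Inv : ℕ → State → Set
    Inv k σ = iregs σ layer ≡ suc k × iregs σ base ≡ k * n × Rows (suc k) (rcells σ)

    body : ∀ σ {k} → k < suc q → Inv k σ →
           evalᴮ (regᴵ layer <ᴵ inputP) σ ≡ true ×
           Runs (nextRow ⨾ base ≔ᴵ inputN +ᴵ regᴵ base ⨾ layer ≔ᴵ regᴵ layer +ᴵ litᴵ 1) σ (n ^ 2)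
             (Inv (suc k))
    body σ {k} k<1+q (layer≡ , base≡ , rows) =
      ⌊⌋-true (_ ℕ.<? p) (subst (_< p) (sym layer≡) (s≤s k<1+q)) , (
      nextRow-runs (s≤s k<1+q) base≡ rows ⟫ λ { {σ′} (base≡ , layer≡′ , rows) →
      let next≡ = trans (ℕ.+-comm (iregs σ′ layer) 1) (cong suc (trans layer≡′ layer≡)) in
      regᴵ-runs (subst (_≤ word) (sym (cong (n ℕ.+_) base≡)) (row≤word (ℕ.<⇒≤ (s≤s k<1+q)))) ⟫ λ { refl →
      regᴵ-runs (subst (_≤ word) (sym next≡) (layer≤word (s≤s k<1+q))) ensuring
        (next≡ , cong (n ℕ.+_) base≡ , rows) } })

  Traced : ℕ → ℕ → Fin n → State → Set
  Traced k s a σ = ∃[ v ] Σ[ P ∈ Path k a v ] UpperBound k a v ×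
                   (∀ i → icells σ (toℕ i ℕ.+ s) ≡ pos (nodes P i))

  Keeps : ℕ → State → State → Set
  Keeps s σ σ′ = (∀ i → i ≤ s → icells σ′ i ≡ icells σ i) × rregs σ′ out ≡ rregs σ out

  -- s is the answer cell written last and k the number of those still to be
  -- written.
  Tracing : ℕ → ℕ → Fin n → State → Set
  Tracing k s a σ = iregs σ base ≡ k * n × iregs σ layer ≡ suc s × iregs σ src ≡ pos a ×
                    icells σ s ≡ pos a × Rows p (rcells σ) × ∃[ v ] Path k a v

  -- Only the value `w` of the tail is settled here. Later steps choose the tail itself and need
  -- only reach `w` for the path from `a` to be optimal.
  traceStep-runs : ∀ {σ k s a} → suc s ℕ.+ suc k ≡ p → Tracing (suc k) s a σ →
    Runs traceStep σ (n * 1)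
      (λ σ′ → Keeps s σ σ′ ×
        ∃[ b ] a Fin.< b × Tracing k (suc s) b σ′ ×
               ∃[ w ] Path k b w × UpperBound (suc k) a (δ a b + w))
  traceStep-runs {σ} {k} {s} {a} s+k≡p (base≡ , layer≡ , src≡a , cell≡a , rows , _ , P) =
    regᴵ-runs (subst (_≤ word) (sym base≡′) (row≤word (ℕ.<⇒≤ k<p))) ⟫ λ { refl →
    searchRow-runs {k = k} base≡′ src≡a ⟫ λ { {σ′} ((same , out≡ , cells≡ , V≡) , found) →
    let c , a<c , w , Q = uncons P
        b , (a<b , feasible) , arg≡b , best≡ =
          found-candidate σ′ found (a<c , ⌊⌋-true (_ <? _) (best-feasible (row c) Q))
            (path-nonneg (best-path (row c) Q))
        layer≡′ = trans (same 2) layer≡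
        next≡ = trans (ℕ.+-comm (iregs σ′ layer) 1) (cong suc layer≡′)
        path-b = feasible-path (row b) (⌊⌋-true⁻¹ (_ <? _) feasible)
        b≤word = subst (_≤ word) (sym arg≡b) (ℕ.≤-trans (ℕ.<⇒≤ (pos<n b)) n≤word)
        upper = subst (UpperBound (suc k) a) best≡ (proj₁ (found-best σ′ k (rcells σ) row found))
    in
    regᴵ-runs b≤word ⟫ λ { refl →
    cellᴵ-runs (subst (_< space) (sym layer≡′) (ℕ.<-≤-trans 1+s<p (ℕ.≤-trans p≤pn pn≤space))) b≤word ⟫ λ { refl →
    regᴵ-runs (subst (_≤ word) (sym next≡) (layer≤word 1+s<p)) ensuring
      (((λ i i≤s → trans ([↦]-old (icells σ′) _ (λ i≡ → ℕ.<⇒≢ (s≤s i≤s) (trans i≡ layer≡′)))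
                         (cong (λ f → f i) cells≡)) , out≡) ,
       b , a<b ,
       (trans (same 1) base≡′ , next≡ , arg≡b ,
        trans ([↦]-new (icells σ′) _ (sym layer≡′)) arg≡b ,
        subst (Rows p) (sym V≡) rows , _ , path-b) ,
       _ , path-b , upper) } } } }
    where
    1+s<p : suc s < p
    1+s<p = subst (suc s <_) s+k≡p (ℕ.m<m+n (suc s) (s≤s z≤n))
    k<p : k < p
    k<p = subst (k <_) s+k≡p (ℕ.m≤n+m (suc k) (suc s))
    row : Row k (rcells σ)
    row = rows k<p
    base≡′ : iregs σ base ℕ.∸ n ≡ k * n
    base≡′ = trans (cong (ℕ._∸ n) base≡) (ℕ.m+n∸m≡n n (k * n))

  -- Recursion on `k` takes the place of `loop-invariant`, because the path is assembled from its
  -- end, after the later iterations have determined its tail.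
  trace-loops : ∀ k {σ s a} → suc s ℕ.+ k ≡ p → Tracing k s a σ →
    Loops (regᴵ layer <ᴵ inputP) traceStep σ k (n * 1)
      (λ σ′ → Keeps s σ σ′ × Traced k s a σ′)
  trace-loops zero {s = s} s+0≡p (_ , layer≡ , _ , cell≡a , _) =
    loop-exit (⌊⌋-false (_ ℕ.<? p) (ℕ.<-irrefl (trans layer≡ (trans (sym (ℕ.+-identityʳ (suc s))) s+0≡p))))
      (((λ _ _ → refl) , refl) , 0# , end , (λ { end → ≤ʳ-refl }) , λ { Fin.zero → cell≡a ; (Fin.suc ()) })
  trace-loops (suc k) {σ} {s} {a} s+k≡p tracing@(_ , layer≡ , _ , cell≡a , _) =
    loop-step (⌊⌋-true (_ ℕ.<? p) (subst (_< p) (sym layer≡) (subst (suc s <_) s+k≡p (ℕ.m<m+n (suc s) (s≤s z≤n)))))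
      (traceStep-runs s+k≡p tracing)
      λ { {σ′} ((cells≡ , out≡) , b , a<b , tracing′ , w , R , upper) →
      weakenLoops
        (λ { {σ″} ((cells≡′ , out≡′) , v , P , bound , cells) →
          ((λ i i≤s → trans (cells≡′ i (ℕ.m≤n⇒m≤1+n i≤s)) (cells≡ i i≤s)) , trans out≡′ out≡) ,
          δ a b + v , step a<b P ,
          -- `R` is some path from `b` of value `w`, so `w` is at most the value `v` of the traced
          -- tail.
          (λ S → ≤ʳ-trans (upper S) (+-monoʳ-≤ʳ (δ a b) (bound R))) ,
          λ { Fin.zero    → trans (cells≡′ s (ℕ.n≤1+n s)) (trans (cells≡ s ℕ.≤-refl) cell≡a)
            ; (Fin.suc i) → trans (cong (icells σ″) (sym (ℕ.+-suc (toℕ i) s))) (cells i) } })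
        (trace-loops k (trans (cong suc (sym (ℕ.+-suc s k))) s+k≡p) tracing′) }

  dynamicProgram-runs : ∀ {σ} → Runs dynamicProgram σ (p * n ^ 2) IsAnswer
  dynamicProgram-runs =
    fillTable-runs ⟫ λ { (base≡ , rows) →
    moreTime n*1≤pn^2 findMin-runs ⟫ λ { {σ} ((same , _ , _ , V≡) , a , src≡a , first) →
    let rows = subst (Rows p) (sym V≡) rows
        base≡ = trans (same 0) base≡
        P₀ = proj₂ (first-path first)
        out≡ = cong₂ (λ i j → rcells σ (i ℕ.+ j)) base≡ src≡a
        best-a = rows ℕ.≤-refl a
    in
    regᴿ-runs ⟫ λ { refl →
    cellᴵ-runs (ℕ.<-≤-trans (s≤s z≤n) (ℕ.≤-trans p≤pn pn≤space))
      (subst (_≤ word) (sym src≡a) (ℕ.≤-trans (ℕ.<⇒≤ (pos<n a)) n≤word)) ⟫ λ { refl →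
    regᴵ-runs (layer≤word (s≤s z≤n)) ⟫ λ { refl →
    -- The trace makes `p - 1` linear searches, which the cost of the table dominates.
    moreTime (ℕ.≤-trans (ℕ.*-monoʳ-≤ (suc q) (ℕ.m≤n*m (n * 1) n)) (ℕ.m≤n+m (suc q * n ^ 2) (n ^ 2))) (
    weaken
      (λ { {σ′} ((_ , out≡′) , v , P , bound , cells) →
        path-answer σ′ first P bound
          -- The table entry and the value of the traced path are both values of paths and upper
          -- bounds, so each is at most the other.
          (trans out≡′ (trans out≡ (≤ʳ-antisym (bound (best-path best-a P₀)) (proj₁ best-a P))))
          (λ i → trans (cong (icells σ′) (sym (ℕ.+-identityʳ (toℕ i)))) (cells i)) })
      (loop-runs (ℕ.≤-refl {suc q}) (trace-loops (suc q) refl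
        (base≡ , refl , src≡a , src≡a , rows , first-path first)))) } } } } }

-- The three complexity bounds

theorem1 : (𝓡 : RealNumbers) (α : RealNumbers.ℝ 𝓡) →
    RealNumbers._<_ 𝓡 (RealNumbers.0# 𝓡) α →
    let open Dispersion 𝓡 α in
    (∃[ c ] ∃[ C ] ∃[ k ] ∃[ w ]
    (∀ {n p} (I : Instance n p) →
    c solves I inTime (C * n ^ k) inSpace (C * n ^ k) withWords (n ^ w)))
    ×
    ((p : ℕ) → p ≡ 2 ⊎ p ≡ 3 →
    ∃[ c ] ∃[ C ] ∃[ w ]
    (∀ {n} (I : Instance n p) →
    c solves I inTime (C * n) inSpace C withWords (n ^ w)))
    ×
    (∃[ c ] ∃[ C ] ∃[ w ]
    (∀ {n p} → 3 < p → (I : Instance n p) →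
    c solves I inTime (C * (p * n ^ 2)) inSpace (C * (p * n)) withWords (n ^ w)))
theorem1 𝓡 α 0<α =
  -- For the polynomial bound, `p ≤ n` turns `p * n ^ 2` into `n ^ 3`. The exponent 2 for words
  -- suffices since table addresses stay below `p * n`, which is at most `n ^ 2`.
  (dynamicProgram , work dynamicProgram , 3 , 2 , dynamic-cubic) ,
  few ,
  (dynamicProgram , work dynamicProgram , 2 , λ _ I → dynamic I)
  where
  open Dispersion 𝓡 α

  times : ∀ {c T M M′} → T ≤ M * work c → M ≤ M′ → T ≤ work c * M′
  times {c} {M′ = M′} T≤ M≤M′ = ℕ.≤-trans T≤
    (ℕ.≤-trans (ℕ.*-monoˡ-≤ (work c) M≤M′) (ℕ.≤-reflexive (ℕ.*-comm M′ (work c))))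

  pn≤n^2 : ∀ {n p} → p ≤ n → p * n ≤ n ^ 2
  pn≤n^2 {n} p≤n = ℕ.≤-trans (ℕ.*-monoˡ-≤ n p≤n) (ℕ.≤-reflexive (cong (n *_) (sym (ℕ.*-identityʳ n))))

  dynamic-within : ∀ {n p time space} (I : Instance n p) → p * n ^ 2 ≤ time → p * n ≤ space →
    dynamicProgram solves I inTime (work dynamicProgram * time) inSpace space withWords (n ^ 2)
  dynamic-within I time≥ space≥ σ with Instance.2≤p I
  ... | s≤s (s≤s z≤n) =
    let t , σ′ , run , t≤ , answer = Triples.halts (dynamicProgram-runs {σ})
    in t , σ′ , run , times {dynamicProgram} t≤ time≥ , answer
    where open Dynamic 𝓡 α 0<α I _ _ space≥ (pn≤n^2 (Instance.p≤n I))

  dynamic : ∀ {n p} (I : Instance n p) →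
    dynamicProgram solves I inTime (work dynamicProgram * (p * n ^ 2))
      inSpace (work dynamicProgram * (p * n)) withWords (n ^ 2)
  dynamic {n} {p} I = dynamic-within I ℕ.≤-refl (ℕ.m≤n*m (p * n) (work dynamicProgram))

  dynamic-cubic : ∀ {n p} (I : Instance n p) →
    dynamicProgram solves I inTime (work dynamicProgram * n ^ 3)
      inSpace (work dynamicProgram * n ^ 3) withWords (n ^ 2)
  dynamic-cubic {n} {p} I = dynamic-within I pn^2≤
    (ℕ.≤-trans (ℕ.≤-trans (ℕ.*-monoʳ-≤ p (ℕ.m≤m*n n n)) (ℕ.≤-trans (ℕ.≤-reflexive n*n) pn^2≤))
      (ℕ.m≤n*m (n ^ 3) (work dynamicProgram)))
    where
    open Instance I using (2≤p; p≤n)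
    instance n≢0 = ℕ.>-nonZero (ℕ.≤-trans (s≤s z≤n) (ℕ.≤-trans 2≤p p≤n))
    n*n : p * (n * n) ≡ p * n ^ 2
    n*n = cong (λ m → p * (n * m)) (sym (ℕ.*-identityʳ n))
    pn^2≤ : p * n ^ 2 ≤ n ^ 3
    pn^2≤ = ℕ.*-monoˡ-≤ (n ^ 2) p≤n

  few : (p : ℕ) → p ≡ 2 ⊎ p ≡ 3 → ∃[ c ] ∃[ C ] ∃[ w ]
    (∀ {n} (I : Instance n p) →
       c solves I inTime (C * n) inSpace C withWords (n ^ w))
  -- One constant must bound both the time factor and the space; `work` of the program exceeds 2,
  -- which leaves room for the answer cells.
  few p (inj₁ refl) = twoPoints , work twoPoints , 1 , λ {n} I σ →
    let open FewPoints 𝓡 α 0<α {n} (work twoPoints) (n ^ 1)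
          (s≤s (s≤s (s≤s z≤n))) (ℕ.≤-reflexive (sym (ℕ.*-identityʳ n)))
        t , σ′ , run , t≤ , answer = Triples.halts (twoPoints-runs I {σ})
    in t , σ′ , run , times {twoPoints} t≤ (ℕ.≤-reflexive (ℕ.*-identityʳ n)) , answer
  few p (inj₂ refl) = threePoints , work threePoints , 1 , λ {n} I σ →
    let open FewPoints 𝓡 α 0<α {n} (work threePoints) (n ^ 1)
          (s≤s (s≤s (s≤s z≤n))) (ℕ.≤-reflexive (sym (ℕ.*-identityʳ n)))
        t , σ′ , run , t≤ , answer = Triples.halts (threePoints-runs I {σ})
    in t , σ′ , run , times {threePoints} t≤ (ℕ.≤-reflexive (ℕ.*-identityʳ n)) , answer
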